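{- Let $q$ be a prime power and let $\mathcal{A}_H$ be the Hall affine plane of order $q^2$ built from a defining polynomial $f(x)=x^2-rx-s$ irreducible over $F_q$ (see context). For every ordered pair of distinct lines $\ell_1,\ell_2$ of $\mathcal{A}_H$ and every two distinct points $A_1,B_1$ on $\ell_1$, neither of which lies on $\ell_2$, there exist a point $C_1$ on $\ell_1$ and three points $A_2,B_2,C_2$ on $\ell_2$ such that $A_1,B_1,C_1,A_2,B_2,C_2$ define a Pappus configuration.
   Context: Let $F=F_q$ be the finite field of prime power order $q$, and let $f(x)=x^2-rx-s$ with $r,s\in F$ be irreducible over $F$. The Hall system is $H=F^2$ with componentwise addition and multiplication defined, for $\mathbf a=(a_1,a_2)$, $\mathbf b=(b_1,b_2)\in H$, by $\mathbf a\mathbf b=(a_1b_1,a_2b_1)$ if $b_2=0$, and $\mathbf a\mathbf b=(a_1b_1-a_2b_2^{ -1}f(b_1),\,a_1b_2-a_2b_1+a_2r)$ if $b_2\neq 0$. The Hall affine plane $\mathcal{A}_H$ has point set $H\times H$; its lines are the sets $\{(\mathbf x,\mathbf x\mathbf m+\mathbf k):\mathbf x\in H\}$ for fixed $\mathbf m,\mathbf k\in H$ (non-vertical lines, with equation $\mathbf y=\mathbf x\mathbf m+\mathbf k$) and the sets $\{(\mathbf c,\mathbf y):\mathbf y\in H\}$ for fixed $\mathbf c\in H$ (vertical lines). It is an affine plane of order $q^2$. Six points $A_1,B_1,C_1$ on a line $\ell_1$ and $A_2,B_2,C_2$ on a line $\ell_2\neq\ell_1$, where the points on each line are pairwise distinct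 and none of the six points lies on both lines, define a Pappus configuration if the three points $A_1B_2\cap A_2B_1$, $A_1C_2\cap A_2C_1$, $B_1C_2\cap B_2C_1$ are collinear, where intersections and collinearity are taken in the projective completion of $\mathcal{A}_H$ (two parallel lines meet in the point at infinity of their parallel class, and the points at infinity form the line at infinity). -}

module Defs where

open import Level using (0ℓ)
open import Data.Nat using (ℕ; _≥_)
open import Data.Nat.Primality using (Prime)
open import Data.Fin using (Fin)
open import Data.Product using (Σ; ∃; ∃-syntax; _×_; _,_)
open import Data.Sum using (_⊎_)
open import Data.Unit using (⊤)
open import Data.Empty using (⊥)
open import Relation.Nullary using (¬_; Dec; yes; no)
open import Relation.Binary.PropositionalEquality using (_≡_; _≢_)
open import Algebra.Structures using (IsCommutativeRing)
open import Function.Bundles using (_↔_; _⇔_)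

IsPrimePower : ℕ → Set
IsPrimePower q = ∃[ p ] ∃[ k ] (Prime p × k ≥ 1 × q ≡ p Data.Nat.^ k)

record FiniteField (q : ℕ) : Set₁ where
  infixl 7 _*_
  infixl 6 _+_
  field
    Carrier : Set
    _+_ _*_ : Carrier → Carrier → Carrier
    -_      : Carrier → Carrier
    0#  1#  : Carrier
    _⁻¹     : Carrier → Carrier
    isCommutativeRing : IsCommutativeRing _≡_ _+_ _*_ -_ 0# 1#
    0≢1     : 0# ≢ 1#
    ⁻¹-inverse : ∀ x → x ≢ 0# → x * (x ⁻¹) ≡ 1#
    _≟_     : (x y : Carrier) → Dec (x ≡ y)
    card    : Carrier ↔ Fin q

module Hall {q : ℕ} (F : FiniteField q) (r s : FiniteField.Carrier F) where
  open FiniteField F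

  _-_ : Carrier → Carrier → Carrier
  a - b = a + (- b)
  infixl 6 _-_

  f : Carrier → Carrier
  f x = x * x - r * x - s

  -- f is irreducible over F: the monic quadratic x^2 - r x - s admits no
  -- factorisation (x - a)(x - b) = x^2 - (a+b) x + a b over F
  -- (a degree-2 polynomial factors nontrivially only into two linear factors,
  --  which may be taken monic).
  Irreducible : Set
  Irreducible = ¬ (∃[ a ] ∃[ b ] (a + b ≡ r × a * b ≡ - s))

  H : Set
  H = Carrier × Carrier

  _⊕_ : H → H → H
  (a₁ , a₂) ⊕ (b₁ , b₂) = (a₁ + b₁ , a₂ + b₂)

  _⊗_ : H → H → H
  (a₁ , a₂) ⊗ (b₁ , b₂) with b₂ ≟ 0#
  ... | yes _ = (a₁ * b₁ , a₂ * b₁)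
  ... | no  _ = (a₁ * b₁ - a₂ * (b₂ ⁻¹) * f b₁ , a₁ * b₂ - a₂ * b₁ + a₂ * r)

  Point : Set
  Point = H × H

  data Line : Set where
    nonvert : (m k : H) → Line
    vert    : (c : H) → Line

  _∈L_ : Point → Line → Set
  (x , y) ∈L nonvert m k = y ≡ (x ⊗ m) ⊕ k
  (x , y) ∈L vert c      = x ≡ c

  SameLine : Line → Line → Set
  SameLine l l' = ∀ P → (P ∈L l) ⇔ (P ∈L l')

  Parallel : Line → Line → Set
  Parallel l l' = SameLine l l' ⊎ (∀ P → P ∈L l → ¬ (P ∈L l'))

  -- Projective completion: a point at infinity is the parallel class of
  -- an affine line (represented by any member of the class).
  data PPoint : Set where
    aff : Point → PPoint
    inf : Line → PPoint

  data PLine : Set where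
    affL    : Line → PLine
    lineInf : PLine

  _∈P_ : PPoint → PLine → Set
  aff P ∈P affL l   = P ∈L l
  aff P ∈P lineInf  = ⊥
  inf l ∈P affL l'  = Parallel l l'
  inf l ∈P lineInf  = ⊤

  OnJoins : PPoint → Point → Point → Point → Point → Set
  OnJoins P X Y Z W =
    ∃[ L ] ∃[ M ] (X ∈L L × Y ∈L L × Z ∈L M × W ∈L M × P ∈P affL L × P ∈P affL M)

  Collinear : PPoint → PPoint → PPoint → Set
  Collinear P Q R = ∃[ N ] (P ∈P N × Q ∈P N × R ∈P N)

  PappusCond : Point → Point → Point → Point → Point → Point → Set
  PappusCond A₁ B₁ C₁ A₂ B₂ C₂ =
    ∃[ P ] ∃[ Q ] ∃[ R ]
      ( OnJoins P A₁ B₂ A₂ B₁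
      × OnJoins Q A₁ C₂ A₂ C₁
      × OnJoins R B₁ C₂ B₂ C₁
      × Collinear P Q R )

  PappusConfiguration : Line → Line → Point → Point → Point → Point → Point → Point → Set
  PappusConfiguration ℓ₁ ℓ₂ A₁ B₁ C₁ A₂ B₂ C₂ =
      ¬ SameLine ℓ₁ ℓ₂
    × (A₁ ∈L ℓ₁ × B₁ ∈L ℓ₁ × C₁ ∈L ℓ₁)
    × (A₂ ∈L ℓ₂ × B₂ ∈L ℓ₂ × C₂ ∈L ℓ₂)
    × (A₁ ≢ B₁ × A₁ ≢ C₁ × B₁ ≢ C₁)
    × (A₂ ≢ B₂ × A₂ ≢ C₂ × B₂ ≢ C₂)
    × (¬ A₁ ∈L ℓ₂ × ¬ B₁ ∈L ℓ₂ × ¬ C₁ ∈L ℓ₂)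
    × (¬ A₂ ∈L ℓ₁ × ¬ B₂ ∈L ℓ₁ × ¬ C₂ ∈L ℓ₁)
    × PappusCond A₁ B₁ C₁ A₂ B₂ C₂

{-# OPTIONS --safe #-}
module Submission where

-- A slope is ∞ or an element m of H; a vector v = (x , y) of F⁴ = H × H has slope m when y = x m. The vectors of a
-- fixed slope form a plane, and these planes partition F⁴ ∖ 0. The net slopes (∞ and m ∈ F) are the planes H ⊗ u
-- with u ∈ F², all other slopes are the lines over F(θ), θ a root of f, for the action of θ on the second tensor factor.
--
-- The Pappus line is always the line at infinity. If ℓ₁ and ℓ₂ are parallel, A₂ ∈ ℓ₂ and C₁ are arbitrary and
-- B₂ = A₂ + A₁ − B₁, C₂ = A₂ + A₁ − C₁. Otherwise take the common point as the origin, with ℓ₁ and ℓ₂ of slopes σ ≠ τ.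
-- If for some γ ≠ 0, 1 there are slopes U, U′ and a map a ↦ z from σ to τ with z − a ∈ U and z − γ a ∈ U′, then
-- c = γ a, a′ = z(b), b′ = z(a), c′ = γ⁻¹ z(b) works (with b and c exchanged if b = γ a). Such a map exists when σ and τ
-- are both net or both non-net (γ = −1 in odd characteristic, any γ otherwise), and in the mixed case with γ = 2 or 1/2
-- in odd characteristic. In the mixed case in characteristic 2 with |F| > 2, dependent a, b are handled by scalars, and
-- independent a, b by six lines of net slope. For F = F₂ the plane is the affine plane over F₄.

-- With the Pappus line at infinity, opposite joins must be parallel, that is, their difference
-- vectors must share a slope plane. A slope U other than σ and τ gives a linear map from σ to τ,
-- sending a to the z with z - a ∈ U; the scalar γ asks for two such maps that differ by the factor
-- γ. Two net planes share the tensor factor H and two non-net planes share F(θ)-linearity, and this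
-- makes z - γ a sweep a slope plane again. A mixed pair has no such common structure: from a net to
-- a non-net plane the maps along net slopes are the inverses of L + ρ for one operator L without
-- eigenvalues, and distinct ones are never proportional. In odd characteristic the conjugate slope
-- r - m supplies a second kind of map, with harmonic factor 2 or 1/2, and this breaks down when 2 =
-- 0. There the net slopes alone are used: the maps L + ρ commute, and three distinct shifts ρ give
-- the six joins, whence |F| > 2.

open import Defs
open import Algebra.Bundles using (CommutativeRing; RawRing)
open import Data.Fin.Properties using (any?)
open import Data.Integer as ℤ using (ℤ; +_; -[1+_]; _⊖_)
import Data.Integer.Properties as ℤₚ
open import Data.Maybe using (Maybe; just; nothing)
open import Data.Nat as ℕ using (ℕ; zero; suc)
import Data.Nat.Properties as ℕₚ
open import Data.Product using (∃-syntax; _×_; _,_; proj₁; proj₂)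
open import Data.Sum using (_⊎_; inj₁; inj₂)
open import Data.Unit using (⊤; tt)
open import Function using (_∘_)
open import Function.Bundles using (mk⇔; Inverse)
open import Level using (0ℓ)
open import Relation.Nullary using (¬_; Dec; yes; no; contradiction)
open import Relation.Nullary.Decidable using (¬?; _×-dec_)
open import Relation.Binary.PropositionalEquality as ≡ using (_≡_; _≢_)

-- Ring solver with integer coefficients.

module IntegerCoefficients {c ℓ} (R : CommutativeRing c ℓ) where
  open CommutativeRing R hiding (zero)
  open import Algebra.Properties.Semiring.Mult.TCOptimised semiring
    using (×-homo-+; ×1-homo-*; 1+×) renaming (_×_ to _×′_)
  open import Algebra.Properties.Ring ring
  open import Algebra.Properties.AbelianGroup +-abelianGroup using (⁻¹-∙-comm)
  open import Algebra.Solver.Ring.AlmostCommutativeRing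
  open import Relation.Binary.Reasoning.Setoid setoid

  -- The field is abstract, so its constants do not compute. Integer coefficients do: like terms
  -- cancel by normalisation and the solver's equations close with `refl`.
  fromℤ : ℤ → Carrier
  fromℤ (+ n)    = n ×′ 1#
  fromℤ -[1+ n ] = - (suc n ×′ 1#)

  fromℤ-neg : ∀ i → fromℤ (ℤ.- i) ≈ - fromℤ i
  fromℤ-neg (+ zero)  = sym -0#≈0#
  fromℤ-neg (+ suc n) = refl
  fromℤ-neg -[1+ n ]  = sym (-‿involutive _)

  fromℤ-⊖ : ∀ m n → fromℤ (m ⊖ n) ≈ m ×′ 1# + - (n ×′ 1#)
  fromℤ-⊖ m zero = begin
    m ×′ 1#              ≈⟨ +-identityʳ _ ⟨
    m ×′ 1# + 0#          ≈⟨ +-congˡ -0#≈0# ⟨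
    m ×′ 1# + - 0#        ∎
  fromℤ-⊖ zero (suc n) = sym (+-identityˡ _)
  fromℤ-⊖ (suc m) (suc n) = begin
    fromℤ (suc m ⊖ suc n)                     ≡⟨ ≡.cong fromℤ (ℤₚ.[1+m]⊖[1+n]≡m⊖n m n) ⟩
    fromℤ (m ⊖ n)                             ≈⟨ fromℤ-⊖ m n ⟩
    m ×′ 1# + - (n ×′ 1#)                       ≈⟨ +-congʳ (+-identityˡ _) ⟨
    0# + m ×′ 1# + - (n ×′ 1#)                  ≈⟨ +-congʳ (+-congʳ (-‿inverseʳ 1#)) ⟨
    1# + - 1# + m ×′ 1# + - (n ×′ 1#)           ≈⟨ +-congʳ (+-assoc _ _ _) ⟩
    1# + (- 1# + m ×′ 1#) + - (n ×′ 1#)         ≈⟨ +-congʳ (+-congˡ (+-comm _ _)) ⟩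
    1# + (m ×′ 1# + - 1#) + - (n ×′ 1#)         ≈⟨ +-congʳ (+-assoc _ _ _) ⟨
    1# + m ×′ 1# + - 1# + - (n ×′ 1#)           ≈⟨ +-assoc _ _ _ ⟩
    1# + m ×′ 1# + (- 1# + - (n ×′ 1#))         ≈⟨ +-congˡ (⁻¹-∙-comm _ _) ⟩
    1# + m ×′ 1# + - (1# + n ×′ 1#)             ≈⟨ +-cong (1+× m 1#) (-‿cong (1+× n 1#)) ⟨
    suc m ×′ 1# + - (suc n ×′ 1#)               ∎

  fromℤ-+ : ∀ i j → fromℤ (i ℤ.+ j) ≈ fromℤ i + fromℤ j
  fromℤ-+ (+ m)    (+ n)    = ×-homo-+ 1# m n
  fromℤ-+ (+ m)    -[1+ n ] = fromℤ-⊖ m (suc n)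
  fromℤ-+ -[1+ m ] (+ n)    = trans (fromℤ-⊖ n (suc m)) (+-comm _ _)
  fromℤ-+ -[1+ m ] -[1+ n ] = begin
    - (suc (suc (m ℕ.+ n)) ×′ 1#)          ≡⟨ ≡.cong (λ k → - (suc k ×′ 1#)) (ℕₚ.+-suc m n) ⟨
    - ((suc m ℕ.+ suc n) ×′ 1#)            ≈⟨ -‿cong (×-homo-+ 1# (suc m) (suc n)) ⟩
    - (suc m ×′ 1# + suc n ×′ 1#)           ≈⟨ ⁻¹-∙-comm _ _ ⟨
    - (suc m ×′ 1#) + - (suc n ×′ 1#)       ∎

  fromℤ-pos* : ∀ m j → fromℤ (+ m ℤ.* j) ≈ fromℤ (+ m) * fromℤ j
  fromℤ-pos* m (+ n) = begin
    fromℤ (+ m ℤ.* + n)   ≡⟨ ≡.cong fromℤ (ℤₚ.pos-* m n) ⟨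
    (m ℕ.* n) ×′ 1#       ≈⟨ ×1-homo-* m n ⟩
    m ×′ 1# * n ×′ 1#      ∎
  fromℤ-pos* m -[1+ n ] = begin
    fromℤ (+ m ℤ.* -[1+ n ])        ≡⟨ ≡.cong fromℤ (ℤₚ.neg-distribʳ-* (+ m) (+ suc n)) ⟨
    fromℤ (ℤ.- (+ m ℤ.* + suc n))   ≈⟨ fromℤ-neg (+ m ℤ.* + suc n) ⟩
    - fromℤ (+ m ℤ.* + suc n)       ≈⟨ -‿cong (fromℤ-pos* m (+ suc n)) ⟩
    - (m ×′ 1# * suc n ×′ 1#)         ≈⟨ -‿distribʳ-* _ _ ⟩
    m ×′ 1# * - (suc n ×′ 1#)         ∎

  fromℤ-* : ∀ i j → fromℤ (i ℤ.* j) ≈ fromℤ i * fromℤ j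
  fromℤ-* (+ m) j = fromℤ-pos* m j
  fromℤ-* -[1+ m ] j = begin
    fromℤ (-[1+ m ] ℤ.* j)        ≡⟨ ≡.cong fromℤ (ℤₚ.neg-distribˡ-* (+ suc m) j) ⟨
    fromℤ (ℤ.- (+ suc m ℤ.* j))   ≈⟨ fromℤ-neg (+ suc m ℤ.* j) ⟩
    - fromℤ (+ suc m ℤ.* j)       ≈⟨ -‿cong (fromℤ-pos* (suc m) j) ⟩
    - (suc m ×′ 1# * fromℤ j)      ≈⟨ -‿distribˡ-* _ _ ⟩
    - (suc m ×′ 1#) * fromℤ j      ∎

  ℤ-rawRing : RawRing 0ℓ 0ℓ
  ℤ-rawRing = CommutativeRing.rawRing ℤₚ.+-*-commutativeRing

  fromℤ-morphism : ℤ-rawRing -Raw-AlmostCommutative⟶ fromCommutativeRing R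
  fromℤ-morphism = record
    { ⟦_⟧    = fromℤ
    ; +-homo = fromℤ-+
    ; *-homo = fromℤ-*
    ; -‿homo = fromℤ-neg
    ; 0-homo = refl
    ; 1-homo = refl
    }

  fromℤ-≟ : ∀ i j → Maybe (fromℤ i ≈ fromℤ j)
  fromℤ-≟ i j with i ℤ.≟ j
  ... | yes i≡j = just (reflexive (≡.cong fromℤ i≡j))
  ... | no  _   = nothing

  open import Algebra.Solver.Ring ℤ-rawRing (fromCommutativeRing R) fromℤ-morphism fromℤ-≟ public

open ≡ using (refl; sym; trans; cong; cong₂; subst; subst₂; module ≡-Reasoning)

-- Field arithmetic.

module FieldProperties {q} (F : FiniteField q) where
  open FiniteField F

  commutativeRing : CommutativeRing 0ℓ 0ℓ
  commutativeRing = record { isCommutativeRing = isCommutativeRing }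

  open IntegerCoefficients commutativeRing public
    using (solve; Polynomial; _:=_; _:+_; _:*_; _:-_; :-_; con)
  open CommutativeRing commutativeRing public
    using (-‿inverseʳ; zeroˡ; zeroʳ; *-identityˡ; *-identityʳ; +-identityˡ; +-identityʳ)

  :0 :1 : ∀ {n} → Polynomial n
  :0 = con (+ 0)
  :1 = con (+ 1)

  infixl 6 _-_
  _-_ : Carrier → Carrier → Carrier
  a - b = a + (- b)

  -- A proof by linear combination: k is the coefficient with which the hypothesis A ≡ B enters.
  modulo : ∀ {A B x y} → A ≡ B → ∀ k → x ≡ y + k * (A - B) → x ≡ y
  modulo {A} {x = x} {y} refl k e = trans e
    (solve 3 (λ A y k → y :+ k :* (A :- A) := y) refl A y k)

  1≢0 : 1# ≢ 0#
  1≢0 e = 0≢1 (sym e)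

  *-cancelˡ : ∀ {x y z} → x ≢ 0# → x * y ≡ x * z → y ≡ z
  *-cancelˡ {x} {y} {z} x≢0 e = modulo e (x ⁻¹) (modulo (⁻¹-inverse x x≢0) (z - y)
    (solve 4 (λ x y z i → y := z :+ i :* (x :* y :- x :* z) :+ (z :- y) :* (x :* i :- :1))
      refl x y z (x ⁻¹)))

  x*y≡0⇒y≡0 : ∀ {x y} → x ≢ 0# → x * y ≡ 0# → y ≡ 0#
  x*y≡0⇒y≡0 {x} x≢0 e = *-cancelˡ x≢0 (trans e (sym (zeroʳ x)))

  *-≢0 : ∀ {x y} → x ≢ 0# → y ≢ 0# → x * y ≢ 0#
  *-≢0 x≢0 y≢0 e = y≢0 (x*y≡0⇒y≡0 x≢0 e)

  ⁻¹-≢0 : ∀ {x} → x ≢ 0# → x ⁻¹ ≢ 0#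
  ⁻¹-≢0 {x} x≢0 e = 1≢0 (trans (sym (⁻¹-inverse x x≢0)) (trans (cong (x *_) e) (zeroʳ x)))

  x-y≡0⇒x≡y : ∀ {x y} → x - y ≡ 0# → x ≡ y
  x-y≡0⇒x≡y {x} {y} e = modulo e 1# (solve 2 (λ x y → x := y :+ :1 :* (x :- y :- :0)) refl x y)

  -x≡0⇒x≡0 : ∀ {x} → - x ≡ 0# → x ≡ 0#
  -x≡0⇒x≡0 {x} e = modulo e (- 1#) (solve 1 (λ x → x := :0 :+ :- :1 :* (:- x :- :0)) refl x)

-- The polynomial f and its norm form.

module HallPlane {q} (F : FiniteField q) (r s : FiniteField.Carrier F)
                 (irreducible : Hall.Irreducible F r s) where
  open FiniteField F public
  open FieldProperties F public hiding (_-_)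
  open Hall F r s public

  -- A root x would split f as (X - x)(X - (r - x)).
  f≢0 : ∀ x → f x ≢ 0#
  f≢0 x e = irreducible (x , r - x ,
    solve 2 (λ x r → x :+ (r :- x) := r) refl x r ,
    modulo e (- 1#) (solve 3 (λ x r s → x :* (r :- x) := :- s :+ :- :1 :* (x :* x :- r :* x :- s :- :0)) refl x r s))

  s≢0 : s ≢ 0#
  s≢0 e = f≢0 0# (modulo e (- 1#)
    (solve 2 (λ r s → :0 :* :0 :- r :* :0 :- s := :0 :+ :- :1 :* (s :- :0)) refl r s))

  -- The norm of α + β θ, where θ is a root of f.
  N : Carrier → Carrier → Carrier
  N α β = α * α + r * α * β - s * β * β

  -- For β ≠ 0 the norm is β² f(- α / β).
  N≢0ʳ : ∀ {α β} → β ≢ 0# → N α β ≢ 0#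
  N≢0ʳ {α} {β} β≢0 e = f≢0 (- (α * b)) (modulo e (b * b) (modulo (⁻¹-inverse β β≢0) (s * (β * b + 1#) - r * α * b)
    (solve 5 (λ α β b r s → (:- (α :* b)) :* (:- (α :* b)) :- r :* (:- (α :* b)) :- s
        := :0 :+ b :* b :* (α :* α :+ r :* α :* β :- s :* β :* β :- :0)
              :+ (s :* (β :* b :+ :1) :- r :* α :* b) :* (β :* b :- :1))
      refl α β b r s)))
    where b = β ⁻¹

  -- Right multiplications as linear maps of H.

  infixr 25 _·_
  infix  20 _⊝_
  _·_ : Carrier → H → H
  c · x = (c * proj₁ x , c * proj₂ x)

  _⊝_ : H → H → H
  x ⊝ y = (proj₁ x - proj₁ y , proj₂ x - proj₂ y)

  0H : H
  0H = (0# , 0#)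

  _≟H_ : (x y : H) → Dec (x ≡ y)
  (x₁ , x₂) ≟H (y₁ , y₂) with x₁ ≟ y₁ | x₂ ≟ y₂
  ... | yes refl | yes refl = yes refl
  ... | no  ≢    | _        = no λ { refl → ≢ refl }
  ... | _        | no ≢     = no λ { refl → ≢ refl }

  pointwise₁ : ∀ {g h : Carrier → Carrier} → (∀ x → g x ≡ h x) →
    ∀ (x : H) → (g (proj₁ x) , g (proj₂ x)) ≡ (h (proj₁ x) , h (proj₂ x))
  pointwise₁ e x = cong₂ _,_ (e _) (e _)

  pointwise₂ : ∀ {g h : Carrier → Carrier → Carrier} → (∀ x y → g x y ≡ h x y) →
    ∀ (x y : H) → (g (proj₁ x) (proj₁ y) , g (proj₂ x) (proj₂ y)) ≡ (h (proj₁ x) (proj₁ y) , h (proj₂ x) (proj₂ y))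
  pointwise₂ e x y = cong₂ _,_ (e _ _) (e _ _)

  pointwise₃ : ∀ {g h : Carrier → Carrier → Carrier → Carrier} → (∀ x y z → g x y z ≡ h x y z) →
    ∀ (x y z : H) → (g (proj₁ x) (proj₁ y) (proj₁ z) , g (proj₂ x) (proj₂ y) (proj₂ z))
                  ≡ (h (proj₁ x) (proj₁ y) (proj₁ z) , h (proj₂ x) (proj₂ y) (proj₂ z))
  pointwise₃ e x y z = cong₂ _,_ (e _ _ _) (e _ _ _)

  ⊗-scalar : ∀ {m} → proj₂ m ≡ 0# → ∀ x → x ⊗ m ≡ proj₁ m · x
  ⊗-scalar {m₁ , m₂} e x with m₂ ≟ 0#
  ... | yes _ = pointwise₁ (λ x → solve 2 (λ x m → x :* m := m :* x) refl x m₁) x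
  ... | no ≢  = contradiction e ≢

  ⊗-linear : ∀ m α x β y → ((α · x) ⊕ (β · y)) ⊗ m ≡ (α · (x ⊗ m)) ⊕ (β · (y ⊗ m))
  ⊗-linear (m₁ , m₂) α x β y with m₂ ≟ 0#
  ... | yes _ = pointwise₂ (λ x y →
    solve 5 (λ α x β y m → (α :* x :+ β :* y) :* m := α :* (x :* m) :+ β :* (y :* m)) refl α x β y m₁) x y
  ... | no _ = cong₂ _,_
    (solve 9 (λ α x₁ x₂ β y₁ y₂ m k g →
        (α :* x₁ :+ β :* y₁) :* m :- (α :* x₂ :+ β :* y₂) :* k :* g
        := α :* (x₁ :* m :- x₂ :* k :* g) :+ β :* (y₁ :* m :- y₂ :* k :* g))
       refl α (proj₁ x) (proj₂ x) β (proj₁ y) (proj₂ y) m₁ (m₂ ⁻¹) (f m₁))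
    (solve 9 (λ α x₁ x₂ β y₁ y₂ m n r →
        (α :* x₁ :+ β :* y₁) :* n :- (α :* x₂ :+ β :* y₂) :* m :+ (α :* x₂ :+ β :* y₂) :* r
        := α :* (x₁ :* n :- x₂ :* m :+ x₂ :* r) :+ β :* (y₁ :* n :- y₂ :* m :+ y₂ :* r))
       refl α (proj₁ x) (proj₂ x) β (proj₁ y) (proj₂ y) m₁ m₂ r)

  :f : ∀ {n} → Polynomial n → Polynomial n → Polynomial n → Polynomial n
  :f r s x = x :* x :- r :* x :- s

  -- Cayley-Hamilton: right multiplication by any m with m₂ ≠ 0 has trace r and determinant m₁ (r -
  -- m₁) + f(m₁) = - s, hence characteristic polynomial f. This is the property of the Hall system
  -- on which everything below rests.
  ⊗-square : ∀ {m} → proj₂ m ≢ 0# → ∀ x → (x ⊗ m) ⊗ m ≡ (r · (x ⊗ m)) ⊕ (s · x)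
  ⊗-square {m₁ , m₂} ≢ x@(x₁ , x₂) with m₂ ≟ 0#
  ... | yes e = contradiction e ≢
  ... | no _ = cong₂ _,_
    (modulo (⁻¹-inverse m₂ ≢) (- (x₁ * f m₁)) (solve 7 (λ x₁ x₂ m n i r s →
      let y₁ = x₁ :* m :- x₂ :* i :* :f r s m ; y₂ = x₁ :* n :- x₂ :* m :+ x₂ :* r in
      y₁ :* m :- y₂ :* i :* :f r s m := r :* y₁ :+ s :* x₁ :+ :- (x₁ :* :f r s m) :* (n :* i :- :1))
      refl x₁ x₂ m₁ m₂ (m₂ ⁻¹) r s))
    (modulo (⁻¹-inverse m₂ ≢) (- (x₂ * f m₁)) (solve 7 (λ x₁ x₂ m n i r s →
      let y₁ = x₁ :* m :- x₂ :* i :* :f r s m ; y₂ = x₁ :* n :- x₂ :* m :+ x₂ :* r in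
      y₁ :* n :- y₂ :* m :+ y₂ :* r := r :* y₂ :+ s :* x₂ :+ :- (x₂ :* :f r s m) :* (n :* i :- :1))
      refl x₁ x₂ m₁ m₂ (m₂ ⁻¹) r s))

  conjugate : H → H
  conjugate (m₁ , m₂) = (r - m₁ , - m₂)

  -- `conjugate` imitates θ ↦ r - θ, the exchange of the roots of f. The coordinate formula survives
  -- because f(r - m₁) = f(m₁).
  ⊗-conjugate : ∀ {m} → proj₂ m ≢ 0# → ∀ x → x ⊗ conjugate m ≡ (r · x) ⊝ (x ⊗ m)
  ⊗-conjugate {m₁ , m₂} ≢ (x₁ , x₂) with m₂ ≟ 0# | (- m₂) ≟ 0#
  ... | yes e | _     = contradiction e ≢
  ... | _     | yes e = contradiction (-x≡0⇒x≡0 e) ≢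
  ... | no _  | no ≢′ = cong₂ _,_
    (modulo (⁻¹-inverse m₂ ≢) (x₂ * j * f m₁) (modulo (⁻¹-inverse (- m₂) ≢′) (x₂ * i * f m₁)
      (solve 8 (λ x₁ x₂ m n i j r s →
        x₁ :* (r :- m) :- x₂ :* j :* :f r s (r :- m)
        := r :* x₁ :- (x₁ :* m :- x₂ :* i :* :f r s m) :+ x₂ :* j :* :f r s m :* (n :* i :- :1)
           :+ x₂ :* i :* :f r s m :* ((:- n) :* j :- :1))
        refl x₁ x₂ m₁ m₂ i j r s)))
    (solve 5 (λ x₁ x₂ m n r →
      x₁ :* (:- n) :- x₂ :* (r :- m) :+ x₂ :* r := r :* x₂ :- (x₁ :* n :- x₂ :* m :+ x₂ :* r))
      refl x₁ x₂ m₁ m₂ r)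
    where i = m₂ ⁻¹
          j = (- m₂) ⁻¹

  ⊗-· : ∀ m α x → (α · x) ⊗ m ≡ α · (x ⊗ m)
  ⊗-· m α x = trans (cong (_⊗ m) (sym (add-zero x))) (trans (⊗-linear m α x 0# x) (add-zero (x ⊗ m)))
    where
    add-zero : ∀ x → (α · x) ⊕ (0# · x) ≡ α · x
    add-zero = pointwise₁ λ x → solve 2 (λ α x → α :* x :+ :0 :* x := α :* x) refl α x

  1⊗ : ∀ m → (1# , 0#) ⊗ m ≡ m
  1⊗ (m₁ , m₂) with m₂ ≟ 0#
  ... | yes e = cong₂ _,_ (*-identityˡ m₁) (trans (zeroˡ m₁) (sym e))
  ... | no _  = cong₂ _,_
    (solve 3 (λ m i g → :1 :* m :- :0 :* i :* g := m) refl m₁ (m₂ ⁻¹) (f m₁))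
    (solve 3 (λ m n r → :1 :* n :- :0 :* m :+ :0 :* r := n) refl m₁ m₂ r)

  0⊗ : ∀ m → 0H ⊗ m ≡ 0H
  0⊗ m = trans (cong (_⊗ m) (sym (cong₂ _,_ (zeroˡ 0#) (zeroˡ 0#))))
               (trans (⊗-· m 0# 0H) (cong₂ _,_ (zeroˡ _) (zeroˡ _)))

  det : H → H → Carrier
  det (x₁ , x₂) (y₁ , y₂) = x₁ * y₂ - x₂ * y₁

  ≢0H : ∀ {x} → x ≢ 0H → proj₁ x ≢ 0# ⊎ proj₂ x ≢ 0#
  ≢0H {x₁ , x₂} x≢0 with x₁ ≟ 0#
  ... | no x₁≢0 = inj₁ x₁≢0
  ... | yes refl = inj₂ λ { refl → x≢0 refl }

  det≡0⇒proportional : ∀ {x y} → x ≢ 0H → det x y ≡ 0# → ∃[ c ] y ≡ c · x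
  det≡0⇒proportional {x₁ , x₂} {y₁ , y₂} x≢0 e with ≢0H x≢0
  ... | inj₁ x₁≢0 = i * y₁ , cong₂ _,_
    (modulo (⁻¹-inverse x₁ x₁≢0) (- y₁)
      (solve 3 (λ x y i → y := i :* y :* x :+ :- y :* (x :* i :- :1)) refl x₁ y₁ i))
    (modulo (⁻¹-inverse x₁ x₁≢0) (- y₂) (modulo e i
      (solve 5 (λ x₁ x₂ y₁ y₂ i → y₂ := i :* y₁ :* x₂ :+ :- y₂ :* (x₁ :* i :- :1) :+ i :* (x₁ :* y₂ :- x₂ :* y₁ :- :0))
        refl x₁ x₂ y₁ y₂ i)))
    where i = x₁ ⁻¹
  ... | inj₂ x₂≢0 = i * y₂ , cong₂ _,_
    (modulo (⁻¹-inverse x₂ x₂≢0) (- y₁) (modulo e (- i)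
      (solve 5 (λ x₁ x₂ y₁ y₂ i → y₁ := i :* y₂ :* x₁ :+ :- y₁ :* (x₂ :* i :- :1) :+ :- i :* (x₁ :* y₂ :- x₂ :* y₁ :- :0))
        refl x₁ x₂ y₁ y₂ i)))
    (modulo (⁻¹-inverse x₂ x₂≢0) (- y₂)
      (solve 3 (λ x y i → y := i :* y :* x :+ :- y :* (x :* i :- :1)) refl x₂ y₂ i))
    where i = x₂ ⁻¹

  det≢0⇒basis : ∀ {x y} → det x y ≢ 0# → ∀ w → ∃[ α ] ∃[ β ] w ≡ (α · x) ⊕ (β · y)
  det≢0⇒basis {x₁ , x₂} {y₁ , y₂} D≢0 (w₁ , w₂) =
    -- Cramer's rule.
    i * (w₁ * y₂ - w₂ * y₁) , i * (x₁ * w₂ - x₂ * w₁) , cong₂ _,_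
    (modulo (⁻¹-inverse D D≢0) (- w₁) (solve 7 (λ x₁ x₂ y₁ y₂ w₁ w₂ i →
      w₁ := i :* (w₁ :* y₂ :- w₂ :* y₁) :* x₁ :+ i :* (x₁ :* w₂ :- x₂ :* w₁) :* y₁
            :+ :- w₁ :* ((x₁ :* y₂ :- x₂ :* y₁) :* i :- :1)) refl x₁ x₂ y₁ y₂ w₁ w₂ i))
    (modulo (⁻¹-inverse D D≢0) (- w₂) (solve 7 (λ x₁ x₂ y₁ y₂ w₁ w₂ i →
      w₂ := i :* (w₁ :* y₂ :- w₂ :* y₁) :* x₂ :+ i :* (x₁ :* w₂ :- x₂ :* w₁) :* y₂
            :+ :- w₂ :* ((x₁ :* y₂ :- x₂ :* y₁) :* i :- :1)) refl x₁ x₂ y₁ y₂ w₁ w₂ i))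
    where D = x₁ * y₂ - x₂ * y₁
          i = D ⁻¹

  ·-≡0 : ∀ {c x} → c ≢ 0# → c · x ≡ 0H → x ≡ 0H
  ·-≡0 c≢0 e = cong₂ _,_ (x*y≡0⇒y≡0 c≢0 (cong proj₁ e)) (x*y≡0⇒y≡0 c≢0 (cong proj₂ e))

  -- Applying `⊗-square` to an eigenvector with eigenvalue c gives f(c) x = 0, and f has no root.
  ⊗-no-eigenvector : ∀ {m} → proj₂ m ≢ 0# → ∀ {x c} → x ⊗ m ≡ c · x → x ≡ 0H
  ⊗-no-eigenvector {m} m₂≢0 {x} {c} e = ·-≡0 (f≢0 c)
    (trans (sym (pointwise₁ (λ x →
        solve 4 (λ c x r s → c :* (c :* x) :- (r :* (c :* x) :+ s :* x) := (c :* c :- r :* c :- s) :* x) refl c x r s) x))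
      (trans (cong (_⊝ ((r · (c · x)) ⊕ (s · x))) square) (pointwise₁ -‿inverseʳ ((r · (c · x)) ⊕ (s · x)))))
    where
    square : c · (c · x) ≡ (r · (c · x)) ⊕ (s · x)
    square = begin
      c · (c · x)               ≡⟨ cong (c ·_) e ⟨
      c · (x ⊗ m)               ≡⟨ ⊗-· m c x ⟨
      (c · x) ⊗ m               ≡⟨ cong (_⊗ m) e ⟨
      (x ⊗ m) ⊗ m               ≡⟨ ⊗-square m₂≢0 x ⟩
      (r · (x ⊗ m)) ⊕ (s · x)   ≡⟨ cong (λ y → (r · y) ⊕ (s · x)) e ⟩
      (r · (c · x)) ⊕ (s · x)   ∎
      where open ≡-Reasoning

  det-⊗≢0 : ∀ {m x} → proj₂ m ≢ 0# → x ≢ 0H → det x (x ⊗ m) ≢ 0#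
  det-⊗≢0 m₂≢0 x≢0 e = x≢0 (⊗-no-eigenvector m₂≢0 (proj₂ (det≡0⇒proportional x≢0 e)))

  -- If the images of the unit vectors are independent, they span H; otherwise the second is c times
  -- the first and (c , -1) lies in the kernel.
  injective⇒surjective : (T : H → H) → (∀ α x β y → T ((α · x) ⊕ (β · y)) ≡ (α · T x) ⊕ (β · T y)) →
    (∀ x → T x ≡ 0H → x ≡ 0H) → ∀ w → ∃[ x ] w ≡ T x
  injective⇒surjective T linear injective w with det (T (1# , 0#)) (T (0# , 1#)) ≟ 0#
  ... | no D≢0 = let (α , β , e) = det≢0⇒basis D≢0 w in _ , trans e (sym (linear α (1# , 0#) β (0# , 1#)))
  ... | yes D≡0 = contradiction (trans (sym (solve 1 (λ c → c :* :0 :+ :- :1 :* :1 := :- :1) refl c)) (cong proj₂ kernel))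
                                λ e → 1≢0 (-x≡0⇒x≡0 e)
    where
    proportional : ∃[ c ] T (0# , 1#) ≡ c · T (1# , 0#)
    proportional = det≡0⇒proportional (λ e → 1≢0 (cong proj₁ (injective _ e))) D≡0
    c = proj₁ proportional
    kernel : (c · (1# , 0#)) ⊕ ((- 1#) · (0# , 1#)) ≡ 0H
    kernel = injective _ (trans (linear c (1# , 0#) (- 1#) (0# , 1#))
      (trans (cong (λ y → (c · T (1# , 0#)) ⊕ ((- 1#) · y)) (proj₂ proportional))
        (pointwise₁ (λ t → solve 2 (λ c t → c :* t :+ :- :1 :* (c :* t) := :0) refl c t) (T (1# , 0#)))))

  ⊗-nonscalar : ∀ {m} → proj₂ m ≢ 0# → ∀ x → x ⊗ m ≡
    ( proj₁ x * proj₁ m - proj₂ x * (proj₂ m ⁻¹) * f (proj₁ m)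
    , proj₁ x * proj₂ m - proj₂ x * proj₁ m + proj₂ x * r )
  ⊗-nonscalar {m₁ , m₂} ≢ x with m₂ ≟ 0#
  ... | yes e = contradiction e ≢
  ... | no _  = refl

  N≢0 : ∀ {α β} → α ≢ 0# ⊎ β ≢ 0# → N α β ≢ 0#
  N≢0 {α} {β} ≢ with β ≟ 0#
  ... | no β≢0 = N≢0ʳ β≢0
  N≢0 {α} (inj₂ 0≢0) | yes refl = contradiction refl 0≢0
  N≢0 {α} (inj₁ α≢0) | yes refl = λ e → *-≢0 α≢0 α≢0 (trans
    (solve 3 (λ α r s → α :* α := α :* α :+ r :* α :* :0 :- s :* :0 :* :0) refl α r s) e)

  ⊗-transitive : ∀ {x} → x ≢ 0H → ∀ y → ∃[ m ] y ≡ x ⊗ m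
  ⊗-transitive {x@(x₁ , x₂)} x≢0 y@(y₁ , y₂) with det x y ≟ 0#
  ... | yes D≡0 = let (c , e) = det≡0⇒proportional x≢0 D≡0 in
    (c , 0#) , trans e (sym (⊗-scalar refl x))
  ... | no D≢0 = (b₁ , b₂) , sym (trans (⊗-nonscalar b₂≢0 x) (cong₂ _,_ first second))
    where
    D = x₁ * y₂ - x₂ * y₁
    i = D ⁻¹
    -- By `⊗-square` the sought map sends x to y and y to r y + s x. Since (1 , 0) ⊗ m = m, its
    -- value at (1 , 0) = i (y₂ x - x₂ y) is m = (b₁ , b₂).
    b₁ = i * (y₁ * y₂ - r * x₂ * y₁ - s * x₁ * x₂)
    b₂ = i * N y₂ (- x₂)
    j = b₂ ⁻¹
    nonzero : y₂ ≢ 0# ⊎ (- x₂) ≢ 0#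
    nonzero with x₂ ≟ 0#
    ... | no x₂≢0 = inj₂ (λ e → x₂≢0 (-x≡0⇒x≡0 e))
    ... | yes e = inj₁ (λ e′ → D≢0 (modulo e (- y₁) (modulo e′ x₁
      (solve 4 (λ x₁ x₂ y₁ y₂ → x₁ :* y₂ :- x₂ :* y₁ := :0 :+ :- y₁ :* (x₂ :- :0) :+ x₁ :* (y₂ :- :0)) refl x₁ x₂ y₁ y₂))))
    b₂≢0 : b₂ ≢ 0#
    b₂≢0 = *-≢0 (⁻¹-≢0 D≢0) (N≢0 nonzero)
    second : x₁ * b₂ - x₂ * b₁ + x₂ * r ≡ y₂
    second = modulo (⁻¹-inverse D D≢0) (y₂ - x₂ * r)
      (solve 7 (λ x₁ x₂ y₁ y₂ i r s →
        x₁ :* (i :* (y₂ :* y₂ :+ r :* y₂ :* :- x₂ :- s :* :- x₂ :* :- x₂))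
        :- x₂ :* (i :* (y₁ :* y₂ :- r :* x₂ :* y₁ :- s :* x₁ :* x₂)) :+ x₂ :* r
        := y₂ :+ (y₂ :- x₂ :* r) :* ((x₁ :* y₂ :- x₂ :* y₁) :* i :- :1)) refl x₁ x₂ y₁ y₂ i r s)
    cleared : (x₁ * b₁ - y₁) * b₂ ≡ x₂ * f b₁
    cleared = modulo second b₁ (modulo (⁻¹-inverse D D≢0) (- (s * x₂))
      (solve 7 (λ x₁ x₂ y₁ y₂ i r s →
        let b₁ = i :* (y₁ :* y₂ :- r :* x₂ :* y₁ :- s :* x₁ :* x₂)
            b₂ = i :* (y₂ :* y₂ :+ r :* y₂ :* :- x₂ :- s :* :- x₂ :* :- x₂) in
        (x₁ :* b₁ :- y₁) :* b₂ := x₂ :* :f r s b₁ :+ b₁ :* (x₁ :* b₂ :- x₂ :* b₁ :+ x₂ :* r :- y₂)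
          :+ :- (s :* x₂) :* ((x₁ :* y₂ :- x₂ :* y₁) :* i :- :1)) refl x₁ x₂ y₁ y₂ i r s))
    first : x₁ * b₁ - x₂ * j * f b₁ ≡ y₁
    first = modulo cleared j (modulo (⁻¹-inverse b₂ b₂≢0) (- (x₁ * b₁ - y₁))
      (solve 7 (λ x₁ x₂ y₁ b₁ b₂ j g →
        x₁ :* b₁ :- x₂ :* j :* g := y₁ :+ j :* ((x₁ :* b₁ :- y₁) :* b₂ :- x₂ :* g)
          :+ :- (x₁ :* b₁ :- y₁) :* (b₂ :* j :- :1)) refl x₁ x₂ y₁ b₁ b₂ j (f b₁)))

  -- Two non-scalar multiplications that agree at x agree, by `⊗-square`, at x ⊗ m too; these two
  -- vectors form a basis, so the maps agree at (1 , 0), where their values are m and n. If just one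
  -- of m, n is scalar, then x would be an eigenvector of the other.
  ⊗-injective : ∀ {x} → x ≢ 0H → ∀ m n → x ⊗ m ≡ x ⊗ n → m ≡ n
  ⊗-injective {x} x≢0 m n e = cases (proj₂ m ≟ 0#) (proj₂ n ≟ 0#)
    where
    scalars : proj₂ m ≡ 0# → proj₂ n ≡ 0# → Dec ((proj₁ m - proj₁ n) ≡ 0#) → m ≡ n
    scalars m₂≡0 n₂≡0 (yes d≡0) = cong₂ _,_ (x-y≡0⇒x≡y d≡0) (trans m₂≡0 (sym n₂≡0))
    scalars m₂≡0 n₂≡0 (no d≢0) = contradiction (·-≡0 d≢0
      (trans (pointwise₁ (λ x → solve 3 (λ m n x → (m :- n) :* x := m :* x :- n :* x) refl (proj₁ m) (proj₁ n) x) x)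
        (trans (cong (_⊝ (proj₁ n · x)) (trans (sym (⊗-scalar m₂≡0 x)) (trans e (⊗-scalar n₂≡0 x))))
          (pointwise₁ -‿inverseʳ (proj₁ n · x))))) x≢0
    nonscalars : proj₂ m ≢ 0# → proj₂ n ≢ 0# → m ≡ n
    nonscalars m₂≢0 n₂≢0 = begin
      m                                                ≡⟨ 1⊗ m ⟨
      (1# , 0#) ⊗ m                                    ≡⟨ expand m ⟩
      (α · (x ⊗ m)) ⊕ (β · ((x ⊗ m) ⊗ m))              ≡⟨ cong (λ z → (α · (x ⊗ m)) ⊕ (β · z)) (⊗-square m₂≢0 x) ⟩
      (α · (x ⊗ m)) ⊕ (β · ((r · (x ⊗ m)) ⊕ (s · x)))  ≡⟨ cong (λ z → (α · z) ⊕ (β · ((r · z) ⊕ (s · x)))) e ⟩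
      (α · (x ⊗ n)) ⊕ (β · ((r · (x ⊗ n)) ⊕ (s · x)))  ≡⟨ cong (λ z → (α · (x ⊗ n)) ⊕ (β · z)) (⊗-square n₂≢0 x) ⟨
      (α · (x ⊗ n)) ⊕ (β · ((x ⊗ n) ⊗ n))              ≡⟨ cong (λ y → (α · (x ⊗ n)) ⊕ (β · (y ⊗ n))) e ⟨
      (α · (x ⊗ n)) ⊕ (β · ((x ⊗ m) ⊗ n))              ≡⟨ expand n ⟨
      (1# , 0#) ⊗ n                                    ≡⟨ 1⊗ n ⟩
      n                                                ∎
      where
      open ≡-Reasoning
      coordinates = det≢0⇒basis (det-⊗≢0 m₂≢0 x≢0) (1# , 0#)
      α = proj₁ coordinates
      β = proj₁ (proj₂ coordinates)
      expand : ∀ k → (1# , 0#) ⊗ k ≡ (α · (x ⊗ k)) ⊕ (β · ((x ⊗ m) ⊗ k))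
      expand k = trans (cong (_⊗ k) (proj₂ (proj₂ coordinates))) (⊗-linear k α x β (x ⊗ m))
    cases : Dec (proj₂ m ≡ 0#) → Dec (proj₂ n ≡ 0#) → m ≡ n
    cases (yes m₂≡0) (yes n₂≡0) = scalars m₂≡0 n₂≡0 ((proj₁ m - proj₁ n) ≟ 0#)
    cases (no m₂≢0)  (no n₂≢0)  = nonscalars m₂≢0 n₂≢0
    cases (yes m₂≡0) (no n₂≢0)  = contradiction (⊗-no-eigenvector n₂≢0 (trans (sym e) (⊗-scalar m₂≡0 x))) x≢0
    cases (no m₂≢0)  (yes n₂≡0) = contradiction (⊗-no-eigenvector m₂≢0 (trans e (⊗-scalar n₂≡0 x))) x≢0

  -- The vector space F⁴ and its partition into slope planes.

  infixl 6 _+ᵥ_ _-ᵥ_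
  infixr 7 _·ᵥ_
  _+ᵥ_ _-ᵥ_ : Point → Point → Point
  v +ᵥ w = (proj₁ v ⊕ proj₁ w , proj₂ v ⊕ proj₂ w)
  v -ᵥ w = (proj₁ v ⊝ proj₁ w , proj₂ v ⊝ proj₂ w)

  _·ᵥ_ : Carrier → Point → Point
  c ·ᵥ v = (c · proj₁ v , c · proj₂ v)

  0ᵥ : Point
  0ᵥ = (0H , 0H)

  _≟ᵥ_ : (v w : Point) → Dec (v ≡ w)
  (x , y) ≟ᵥ (x′ , y′) with x ≟H x′ | y ≟H y′
  ... | yes refl | yes refl = yes refl
  ... | no  ≢    | _        = no λ { refl → ≢ refl }
  ... | _        | no ≢     = no λ { refl → ≢ refl }

  coordinatewise₁ : ∀ {g h : Carrier → Carrier} → (∀ x → g x ≡ h x) → ∀ (v : Point) →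
    ((g (proj₁ (proj₁ v)) , g (proj₂ (proj₁ v))) , (g (proj₁ (proj₂ v)) , g (proj₂ (proj₂ v)))) ≡
    ((h (proj₁ (proj₁ v)) , h (proj₂ (proj₁ v))) , (h (proj₁ (proj₂ v)) , h (proj₂ (proj₂ v))))
  coordinatewise₁ e v = cong₂ _,_ (pointwise₁ e _) (pointwise₁ e _)

  coordinatewise₂ : ∀ {g h : Carrier → Carrier → Carrier} → (∀ x y → g x y ≡ h x y) → ∀ (v w : Point) →
    ((g (proj₁ (proj₁ v)) (proj₁ (proj₁ w)) , g (proj₂ (proj₁ v)) (proj₂ (proj₁ w))) ,
     (g (proj₁ (proj₂ v)) (proj₁ (proj₂ w)) , g (proj₂ (proj₂ v)) (proj₂ (proj₂ w)))) ≡
    ((h (proj₁ (proj₁ v)) (proj₁ (proj₁ w)) , h (proj₂ (proj₁ v)) (proj₂ (proj₁ w))) ,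
     (h (proj₁ (proj₂ v)) (proj₁ (proj₂ w)) , h (proj₂ (proj₂ v)) (proj₂ (proj₂ w))))
  coordinatewise₂ e v w = cong₂ _,_ (pointwise₂ e _ _) (pointwise₂ e _ _)

  coordinatewise₃ : ∀ {g h : Carrier → Carrier → Carrier → Carrier} → (∀ x y z → g x y z ≡ h x y z) →
    ∀ (u v w : Point) →
    ((g (proj₁ (proj₁ u)) (proj₁ (proj₁ v)) (proj₁ (proj₁ w)) , g (proj₂ (proj₁ u)) (proj₂ (proj₁ v)) (proj₂ (proj₁ w))) ,
     (g (proj₁ (proj₂ u)) (proj₁ (proj₂ v)) (proj₁ (proj₂ w)) , g (proj₂ (proj₂ u)) (proj₂ (proj₂ v)) (proj₂ (proj₂ w)))) ≡
    ((h (proj₁ (proj₁ u)) (proj₁ (proj₁ v)) (proj₁ (proj₁ w)) , h (proj₂ (proj₁ u)) (proj₂ (proj₁ v)) (proj₂ (proj₁ w))) ,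
     (h (proj₁ (proj₂ u)) (proj₁ (proj₂ v)) (proj₁ (proj₂ w)) , h (proj₂ (proj₂ u)) (proj₂ (proj₂ v)) (proj₂ (proj₂ w))))
  coordinatewise₃ e u v w = cong₂ _,_ (pointwise₃ e _ _ _) (pointwise₃ e _ _ _)

  coordinatewise₄ : ∀ {g h : Carrier → Carrier → Carrier → Carrier → Carrier} → (∀ x y z w → g x y z w ≡ h x y z w) →
    ∀ (u v w x : Point) →
    ((g (proj₁ (proj₁ u)) (proj₁ (proj₁ v)) (proj₁ (proj₁ w)) (proj₁ (proj₁ x)) ,
      g (proj₂ (proj₁ u)) (proj₂ (proj₁ v)) (proj₂ (proj₁ w)) (proj₂ (proj₁ x))) ,
     (g (proj₁ (proj₂ u)) (proj₁ (proj₂ v)) (proj₁ (proj₂ w)) (proj₁ (proj₂ x)) ,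
      g (proj₂ (proj₂ u)) (proj₂ (proj₂ v)) (proj₂ (proj₂ w)) (proj₂ (proj₂ x)))) ≡
    ((h (proj₁ (proj₁ u)) (proj₁ (proj₁ v)) (proj₁ (proj₁ w)) (proj₁ (proj₁ x)) ,
      h (proj₂ (proj₁ u)) (proj₂ (proj₁ v)) (proj₂ (proj₁ w)) (proj₂ (proj₁ x))) ,
     (h (proj₁ (proj₂ u)) (proj₁ (proj₂ v)) (proj₁ (proj₂ w)) (proj₁ (proj₂ x)) ,
      h (proj₂ (proj₂ u)) (proj₂ (proj₂ v)) (proj₂ (proj₂ w)) (proj₂ (proj₂ x))))
  coordinatewise₄ e u v w x = cong₂ _,_ (cong₂ _,_ (e _ _ _ _) (e _ _ _ _)) (cong₂ _,_ (e _ _ _ _) (e _ _ _ _))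

  ·ᵥ-≡0 : ∀ {c v} → c ≢ 0# → c ·ᵥ v ≡ 0ᵥ → v ≡ 0ᵥ
  ·ᵥ-≡0 c≢0 e = cong₂ _,_ (·-≡0 c≢0 (cong proj₁ e)) (·-≡0 c≢0 (cong proj₂ e))

  v-v≡0 : ∀ v → v -ᵥ v ≡ 0ᵥ
  v-v≡0 = coordinatewise₁ -‿inverseʳ

  v-w≡0⇒v≡w : ∀ {v w} → v -ᵥ w ≡ 0ᵥ → v ≡ w
  v-w≡0⇒v≡w {v} {w} e = trans (coordinatewise₂ (λ x y → solve 2 (λ x y → x := x :- y :+ y) refl x y) v w)
    (trans (cong (_+ᵥ w) e) (coordinatewise₁ +-identityˡ w))

  data Slope : Set where
    ∞   : Slope
    fin : H → Slope

  Dir : Slope → Point → Set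
  Dir ∞       v = proj₁ v ≡ 0H
  Dir (fin m) v = proj₂ v ≡ proj₁ v ⊗ m

  fin-injective : ∀ {m n} → fin m ≡ fin n → m ≡ n
  fin-injective refl = refl

  _≟ₛ_ : (σ τ : Slope) → Dec (σ ≡ τ)
  ∞     ≟ₛ ∞     = yes refl
  ∞     ≟ₛ fin _ = no λ ()
  fin _ ≟ₛ ∞     = no λ ()
  fin m ≟ₛ fin n with m ≟H n
  ... | yes refl = yes refl
  ... | no m≢n   = no λ e → m≢n (fin-injective e)

  Dir-combination : ∀ σ {v w} α β → Dir σ v → Dir σ w → Dir σ (α ·ᵥ v +ᵥ β ·ᵥ w)
  Dir-combination ∞ α β refl refl = pointwise₁ (λ _ → solve 2 (λ α β → α :* :0 :+ β :* :0 := :0) refl α β) 0H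
  Dir-combination (fin m) {x , _} {x′ , _} α β refl refl = sym (⊗-linear m α x β x′)

  Dir-+ : ∀ σ {v w} → Dir σ v → Dir σ w → Dir σ (v +ᵥ w)
  Dir-+ σ {v} {w} d e = subst (Dir σ)
    (coordinatewise₂ (λ x y → solve 2 (λ x y → :1 :* x :+ :1 :* y := x :+ y) refl x y) v w) (Dir-combination σ 1# 1# d e)

  Dir-- : ∀ σ {v w} → Dir σ v → Dir σ w → Dir σ (v -ᵥ w)
  Dir-- σ {v} {w} d e = subst (Dir σ)
    (coordinatewise₂ (λ x y → solve 2 (λ x y → :1 :* x :+ :- :1 :* y := x :- y) refl x y) v w)
    (Dir-combination σ 1# (- 1#) d e)

  Dir-· : ∀ σ {v} c → Dir σ v → Dir σ (c ·ᵥ v)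
  Dir-· σ {v} c d = subst (Dir σ)
    (coordinatewise₁ (λ x → solve 2 (λ c x → c :* x :+ :0 :* x := c :* x) refl c x) v)
    (Dir-combination σ c 0# d d)

  Dir-exists : ∀ v → ∃[ σ ] Dir σ v
  Dir-exists (x , y) with x ≟H 0H
  ... | yes x≡0 = ∞ , x≡0
  ... | no x≢0  = let (m , e) = ⊗-transitive x≢0 y in fin m , e

  Dir-unique : ∀ {v} → v ≢ 0ᵥ → ∀ σ τ → Dir σ v → Dir τ v → σ ≡ τ
  Dir-unique v≢0 ∞ ∞ _ _ = refl
  Dir-unique v≢0 ∞ (fin m) refl e = contradiction (cong (0H ,_) (trans e (0⊗ m))) v≢0
  Dir-unique v≢0 (fin m) ∞ e refl = contradiction (cong (0H ,_) (trans e (0⊗ m))) v≢0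
  Dir-unique {x , _} v≢0 (fin m) (fin n) refl e with x ≟H 0H
  ... | yes refl = contradiction (cong (0H ,_) (0⊗ m)) v≢0
  ... | no x≢0 = cong fin (⊗-injective x≢0 m n e)

  Dir-disjoint : ∀ {σ τ} → σ ≢ τ → ∀ {v} → Dir σ v → Dir τ v → v ≡ 0ᵥ
  Dir-disjoint σ≢τ {v} d e with v ≟ᵥ 0ᵥ
  ... | yes v≡0 = v≡0
  ... | no v≢0 = contradiction (Dir-unique v≢0 _ _ d e) σ≢τ

  -- Lines as cosets of the slope planes.

  slope : Line → Slope
  slope (nonvert m k) = fin m
  slope (vert c)      = ∞

  difference-Dir : ∀ ℓ {P Q} → P ∈L ℓ → Q ∈L ℓ → Dir (slope ℓ) (Q -ᵥ P)
  difference-Dir (vert c) refl refl = pointwise₁ -‿inverseʳ c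
  difference-Dir (nonvert m k) {x , _} {x′ , _} refl refl = trans
    (pointwise₃ (λ a b k → solve 3 (λ a b k → a :+ k :- (b :+ k) := :1 :* a :+ :- :1 :* b) refl a b k) (x′ ⊗ m) (x ⊗ m) k)
    (trans (sym (⊗-linear m 1# x′ (- 1#) x))
      (cong (_⊗ m) (pointwise₂ (λ x y → solve 2 (λ x y → :1 :* x :+ :- :1 :* y := x :- y) refl x y) x′ x)))

  translate-∈ : ∀ ℓ {P v} → P ∈L ℓ → Dir (slope ℓ) v → (P +ᵥ v) ∈L ℓ
  translate-∈ (vert c) refl refl = pointwise₁ +-identityʳ c
  translate-∈ (nonvert m k) {x , _} {x′ , _} refl refl = trans
    (pointwise₃ (λ a b k → solve 3 (λ a b k → a :+ k :+ b := :1 :* a :+ :1 :* b :+ k) refl a b k) (x ⊗ m) (x′ ⊗ m) k)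
    (cong (_⊕ k) (trans (sym (⊗-linear m 1# x 1# x′))
      (cong (_⊗ m) (pointwise₂ (λ x y → solve 2 (λ x y → :1 :* x :+ :1 :* y := x :+ y) refl x y) x x′))))

  P+[Q-P]≡Q : ∀ P Q → P +ᵥ (Q -ᵥ P) ≡ Q
  P+[Q-P]≡Q = coordinatewise₂ (λ x y → solve 2 (λ x y → x :+ (y :- x) := y) refl x y)

  Dir⇒∈ : ∀ ℓ {P Q} → P ∈L ℓ → Dir (slope ℓ) (Q -ᵥ P) → Q ∈L ℓ
  Dir⇒∈ ℓ {P} {Q} P∈ℓ d = subst (_∈L ℓ) (P+[Q-P]≡Q P Q) (translate-∈ ℓ P∈ℓ d)

  lineAt : ∀ P σ → ∃[ ℓ ] (P ∈L ℓ × slope ℓ ≡ σ)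
  lineAt (x , y) ∞       = vert x , refl , refl
  lineAt (x , y) (fin m) = nonvert m (y ⊝ (x ⊗ m)) ,
    pointwise₂ (λ y a → solve 2 (λ y a → y := a :+ (y :- a)) refl y a) y (x ⊗ m) , refl

  ∈L? : ∀ P ℓ → Dec (P ∈L ℓ)
  ∈L? (x , y) (nonvert m k) = y ≟H ((x ⊗ m) ⊕ k)
  ∈L? (x , y) (vert c)      = x ≟H c

  point-on : ∀ ℓ → ∃[ P ] P ∈L ℓ
  point-on (nonvert m k) = (0H , (0H ⊗ m) ⊕ k) , refl
  point-on (vert c)      = (c , 0H) , refl

  slope≡⇒Parallel : ∀ ℓ ℓ′ → slope ℓ ≡ slope ℓ′ → Parallel ℓ ℓ′
  slope≡⇒Parallel ℓ ℓ′ e with point-on ℓ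
  ... | P , P∈ℓ with ∈L? P ℓ′
  ... | yes P∈ℓ′ = inj₁ λ Q → mk⇔
    (λ Q∈ℓ → Dir⇒∈ ℓ′ P∈ℓ′ (subst (λ σ → Dir σ (Q -ᵥ P)) e (difference-Dir ℓ P∈ℓ Q∈ℓ)))
    (λ Q∈ℓ′ → Dir⇒∈ ℓ P∈ℓ (subst (λ σ → Dir σ (Q -ᵥ P)) (sym e) (difference-Dir ℓ′ P∈ℓ′ Q∈ℓ′)))
  ... | no P∉ℓ′ = inj₂ λ Q Q∈ℓ Q∈ℓ′ → P∉ℓ′
    (Dir⇒∈ ℓ′ Q∈ℓ′ (subst (λ σ → Dir σ (P -ᵥ Q)) e (difference-Dir ℓ Q∈ℓ P∈ℓ)))

  -- For two non-vertical lines the abscissa solves x ⊗ m - x ⊗ m′ = k′ - k. The left side is linear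
  -- in x and injective by `⊗-injective`, hence surjective.
  slope≢⇒meet : ∀ ℓ ℓ′ → slope ℓ ≢ slope ℓ′ → ∃[ O ] (O ∈L ℓ × O ∈L ℓ′)
  slope≢⇒meet (vert c) (vert c′) ≢ = contradiction refl ≢
  slope≢⇒meet (vert c) (nonvert m k) _ = (c , (c ⊗ m) ⊕ k) , refl , refl
  slope≢⇒meet (nonvert m k) (vert c) _ = (c , (c ⊗ m) ⊕ k) , refl , refl
  slope≢⇒meet (nonvert m k) (nonvert m′ k′) ≢ =
    let (x , e) = injective⇒surjective (λ x → (x ⊗ m) ⊝ (x ⊗ m′))
          (λ α x β y → trans (cong₂ _⊝_ (⊗-linear m α x β y) (⊗-linear m′ α x β y))
            (cong₂ _,_ (regroup α β _ _ _ _) (regroup α β _ _ _ _)))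
          injective (k′ ⊝ k)
    in (x , (x ⊗ m) ⊕ k) , refl ,
       trans (pointwise₃ (λ a b k → solve 3 (λ a b k → a :+ k := b :+ (a :- b) :+ k) refl a b k) (x ⊗ m) (x ⊗ m′) k)
         (trans (cong (λ d → ((x ⊗ m′) ⊕ d) ⊕ k) (sym e))
           (pointwise₃ (λ b k k′ → solve 3 (λ b k k′ → b :+ (k′ :- k) :+ k := b :+ k′) refl b k k′) (x ⊗ m′) k k′))
    where
    regroup : ∀ α β a b c d → α * a + β * b - (α * c + β * d) ≡ α * (a - c) + β * (b - d)
    regroup = solve 6 (λ α β a b c d → α :* a :+ β :* b :- (α :* c :+ β :* d) := α :* (a :- c) :+ β :* (b :- d)) refl
    injective : ∀ x → (x ⊗ m) ⊝ (x ⊗ m′) ≡ 0H → x ≡ 0H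
    injective x e with x ≟H 0H
    ... | yes x≡0 = x≡0
    ... | no x≢0 = contradiction (cong fin (⊗-injective x≢0 m m′
          (cong₂ _,_ (x-y≡0⇒x≡y (cong proj₁ e)) (x-y≡0⇒x≡y (cong proj₂ e))))) ≢

  -- The Pappus condition with the line at infinity.

  Par : Point → Point → Set
  Par v w = ∃[ σ ] (Dir σ v × Dir σ w)

  Par-sym : ∀ {v w} → Par v w → Par w v
  Par-sym (σ , d , e) = σ , e , d

  Par⇒OnJoins : ∀ {A₁ B₁ A₂ B₂} → Par (B₂ -ᵥ A₁) (A₂ -ᵥ B₁) → ∃[ ℓ ] OnJoins (inf ℓ) A₁ B₂ A₂ B₁
  Par⇒OnJoins {A₁} {B₁} (σ , d , e) with lineAt A₁ σ | lineAt B₁ σ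
  ... | L , A₁∈L , refl | M , B₁∈M , eq =
    L , L , M , A₁∈L , Dir⇒∈ L A₁∈L d , Dir⇒∈ M B₁∈M (subst (λ σ → Dir σ _) (sym eq) e) , B₁∈M ,
    slope≡⇒Parallel L L refl , slope≡⇒Parallel L M (sym eq)

  Par⇒PappusCond : ∀ {A₁ B₁ C₁ A₂ B₂ C₂} → Par (B₂ -ᵥ A₁) (A₂ -ᵥ B₁) → Par (C₂ -ᵥ A₁) (A₂ -ᵥ C₁) →
    Par (C₂ -ᵥ B₁) (B₂ -ᵥ C₁) → PappusCond A₁ B₁ C₁ A₂ B₂ C₂
  Par⇒PappusCond p p′ p″ =
    let (P , j) = Par⇒OnJoins p ; (Q , j′) = Par⇒OnJoins p′ ; (R , j″) = Par⇒OnJoins p″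
    in inf P , inf Q , inf R , j , j′ , j″ , lineInf , tt , tt , tt

  ·ᵥ-cancelʳ : ∀ {v α β} → v ≢ 0ᵥ → α ·ᵥ v ≡ β ·ᵥ v → α ≡ β
  ·ᵥ-cancelʳ {v} {α} {β} v≢0 e with (α - β) ≟ 0#
  ... | yes d≡0 = x-y≡0⇒x≡y d≡0
  ... | no d≢0 = contradiction (·ᵥ-≡0 d≢0
    (trans (coordinatewise₁ (λ x → solve 3 (λ α β x → (α :- β) :* x := α :* x :- β :* x) refl α β x) v)
      (trans (cong (_-ᵥ (β ·ᵥ v)) e) (v-v≡0 (β ·ᵥ v))))) v≢0

  1·ᵥ : ∀ v → 1# ·ᵥ v ≡ v
  1·ᵥ = coordinatewise₁ *-identityˡ

  0·ᵥ : ∀ v → 0# ·ᵥ v ≡ 0ᵥ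
  0·ᵥ = coordinatewise₁ zeroˡ

  ⊗-independent : ∀ x → ∃[ y ] (∀ c → y ≢ c · x)
  ⊗-independent (x₁ , x₂) with x₁ ≟ 0#
  ... | yes refl = (1# , 0#) , λ c e → 1≢0 (trans (cong proj₁ e) (zeroʳ c))
  ... | no x₁≢0 = (0# , 1#) , λ c e → 1≢0 (trans (cong proj₂ e)
    (trans (cong (_* x₂) (x*y≡0⇒y≡0 x₁≢0 (modulo (cong proj₁ e) (- 1#)
      (solve 2 (λ c x → x :* c := :0 :+ :- :1 :* (:0 :- c :* x)) refl c x₁)))) (zeroˡ x₂)))

  -- A slope plane has dimension two over F, so the multiples of v do not exhaust it. This supplies
  -- third points even over F₂, where scalars give none.
  independent : ∀ σ v → ∃[ w ] (Dir σ w × (∀ c → w ≢ c ·ᵥ v))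
  independent ∞ (x , y) = let (y′ , y′≢) = ⊗-independent y in
    (0H , y′) , refl , λ c e → y′≢ c (cong proj₂ e)
  independent (fin m) (x , y) = let (x′ , x′≢) = ⊗-independent x in
    (x′ , x′ ⊗ m) , refl , λ c e → x′≢ c (cong proj₁ e)

  nonzero-in : ∀ σ → ∃[ v ] (Dir σ v × v ≢ 0ᵥ)
  nonzero-in σ = let (v , d , v≢) = independent σ 0ᵥ in
    v , d , λ e → v≢ 0# (trans e (sym (0·ᵥ 0ᵥ)))

  Par-· : ∀ {v w} c → v ≡ c ·ᵥ w → Par v w
  Par-· {w = w} c refl = let (σ , d) = Dir-exists w in σ , Dir-· σ c d , d

  Par-≡ : ∀ {v w} → v ≡ w → Par v w
  Par-≡ {v} refl = let (σ , d) = Dir-exists v in σ , d , d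

  Dir-flip : ∀ σ {v w} → Dir σ (v -ᵥ w) → Dir σ (w -ᵥ v)
  Dir-flip σ {v} {w} d = subst (Dir σ)
    (coordinatewise₂ (λ x y → solve 2 (λ x y → :- :1 :* (x :- y) := y :- x) refl x y) v w) (Dir-· σ (- 1#) d)

  -- The vectors from the common point of two lines of slopes σ and τ to the six points of a Pappus
  -- configuration whose Pappus line is the line at infinity.
  record Affine (σ τ : Slope) (a b c a′ b′ c′ : Point) : Set where
    field
      on : Dir σ a × Dir σ b × Dir σ c
      on′ : Dir τ a′ × Dir τ b′ × Dir τ c′
      nonzero : a ≢ 0ᵥ × b ≢ 0ᵥ × c ≢ 0ᵥ
      nonzero′ : a′ ≢ 0ᵥ × b′ ≢ 0ᵥ × c′ ≢ 0ᵥ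
      distinct : a ≢ b × a ≢ c × b ≢ c
      distinct′ : a′ ≢ b′ × a′ ≢ c′ × b′ ≢ c′
      ab : Par (b′ -ᵥ a) (a′ -ᵥ b)
      ac : Par (c′ -ᵥ a) (a′ -ᵥ c)
      bc : Par (c′ -ᵥ b) (b′ -ᵥ c)

  Completable : Slope → Slope → Point → Point → Set
  Completable σ τ a b = ∃[ c ] ∃[ a′ ] ∃[ b′ ] ∃[ c′ ] Affine σ τ a b c a′ b′ c′

  Affine-swap : ∀ {σ τ a b c a′ b′ c′} → Affine σ τ a b c a′ b′ c′ → Affine σ τ a c b a′ c′ b′
  Affine-swap A = record
    { on = let (a , b , c) = on in a , c , b
    ; on′ = let (a , b , c) = on′ in a , c , b
    ; nonzero = let (a , b , c) = nonzero in a , c , b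
    ; nonzero′ = let (a , b , c) = nonzero′ in a , c , b
    ; distinct = let (ab , ac , bc) = distinct in ac , ab , λ e → bc (sym e)
    ; distinct′ = let (ab , ac , bc) = distinct′ in ac , ab , λ e → bc (sym e)
    ; ab = ac ; ac = ab ; bc = Par-sym bc }
    where open Affine A

  Affine-dual : ∀ {σ τ a b c a′ b′ c′} → Affine σ τ a b c a′ b′ c′ → Affine τ σ a′ b′ c′ a b c
  Affine-dual A = record
    { on = on′ ; on′ = on ; nonzero = nonzero′ ; nonzero′ = nonzero ; distinct = distinct′ ; distinct′ = distinct
    ; ab = flip ab ; ac = flip ac ; bc = flip bc }
    where
    open Affine A
    flip : ∀ {v w v′ w′} → Par (v -ᵥ w) (v′ -ᵥ w′) → Par (w′ -ᵥ v′) (w -ᵥ v)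
    flip {v} {w} {v′} {w′} (σ , d , e) = σ , Dir-flip σ {v′} {w′} e , Dir-flip σ {v} {w} d

  [O+v]-O≡v : ∀ O v → (O +ᵥ v) -ᵥ O ≡ v
  [O+v]-O≡v = coordinatewise₂ (λ x y → solve 2 (λ x y → x :+ y :- x := y) refl x y)

  +ᵥ-cancelˡ : ∀ O {v w} → O +ᵥ v ≡ O +ᵥ w → v ≡ w
  +ᵥ-cancelˡ O {v} {w} e = trans (sym ([O+v]-O≡v O v)) (trans (cong (_-ᵥ O) e) ([O+v]-O≡v O w))

  Affine⇒Pappus : ∀ {ℓ₁ ℓ₂ O a b c a′ b′ c′} → ¬ SameLine ℓ₁ ℓ₂ → slope ℓ₁ ≢ slope ℓ₂ → O ∈L ℓ₁ → O ∈L ℓ₂ →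
    Affine (slope ℓ₁) (slope ℓ₂) a b c a′ b′ c′ →
    PappusConfiguration ℓ₁ ℓ₂ (O +ᵥ a) (O +ᵥ b) (O +ᵥ c) (O +ᵥ a′) (O +ᵥ b′) (O +ᵥ c′)
  Affine⇒Pappus {ℓ₁} {ℓ₂} {O} ≢ℓ σ≢τ O∈ℓ₁ O∈ℓ₂ A =
      ≢ℓ
    , (let (da , db , dc) = on in translate-∈ ℓ₁ O∈ℓ₁ da , translate-∈ ℓ₁ O∈ℓ₁ db , translate-∈ ℓ₁ O∈ℓ₁ dc)
    , (let (da , db , dc) = on′ in translate-∈ ℓ₂ O∈ℓ₂ da , translate-∈ ℓ₂ O∈ℓ₂ db , translate-∈ ℓ₂ O∈ℓ₂ dc)
    , (let (ab , ac , bc) = distinct in ab ∘ +ᵥ-cancelˡ O , ac ∘ +ᵥ-cancelˡ O , bc ∘ +ᵥ-cancelˡ O)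
    , (let (ab , ac , bc) = distinct′ in ab ∘ +ᵥ-cancelˡ O , ac ∘ +ᵥ-cancelˡ O , bc ∘ +ᵥ-cancelˡ O)
    , (let (da , db , dc) = on ; (a , b , c) = nonzero in ∉ ℓ₂ O∈ℓ₂ σ≢τ da a , ∉ ℓ₂ O∈ℓ₂ σ≢τ db b , ∉ ℓ₂ O∈ℓ₂ σ≢τ dc c)
    , (let (da , db , dc) = on′ ; (a , b , c) = nonzero′ ; τ≢σ = σ≢τ ∘ sym in
        ∉ ℓ₁ O∈ℓ₁ τ≢σ da a , ∉ ℓ₁ O∈ℓ₁ τ≢σ db b , ∉ ℓ₁ O∈ℓ₁ τ≢σ dc c)
    , Par⇒PappusCond (translated ab) (translated ac) (translated bc)
    where
    open Affine A
    ∉ : ∀ ℓ → O ∈L ℓ → ∀ {σ v} → σ ≢ slope ℓ → Dir σ v → v ≢ 0ᵥ → ¬ (O +ᵥ v) ∈L ℓ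
    ∉ ℓ O∈ℓ {σ} {v} σ≢ d v≢0 O+v∈ℓ = v≢0 (Dir-disjoint σ≢ d
      (subst (Dir (slope ℓ)) ([O+v]-O≡v O v) (difference-Dir ℓ O∈ℓ O+v∈ℓ)))
    translated : ∀ {v w v′ w′} → Par (v -ᵥ w) (v′ -ᵥ w′) →
      Par ((O +ᵥ v) -ᵥ (O +ᵥ w)) ((O +ᵥ v′) -ᵥ (O +ᵥ w′))
    translated {v} {w} {v′} {w′} = subst₂ Par (sym (shift O v w)) (sym (shift O v′ w′))
      where shift = coordinatewise₃ (λ o x y → solve 3 (λ o x y → (o :+ x) :- (o :+ y) := x :- y) refl o x y)

  -- Opposite joins have equal difference vectors: T - B for the pair AB, T - C for AC and T + A - B
  -- - C for BC.
  parallel-case : ∀ {ℓ₁ ℓ₂} → ¬ SameLine ℓ₁ ℓ₂ → slope ℓ₁ ≡ slope ℓ₂ →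
    ∀ {A₁ B₁} → A₁ ≢ B₁ → A₁ ∈L ℓ₁ → B₁ ∈L ℓ₁ →
    ∃[ C₁ ] ∃[ A₂ ] ∃[ B₂ ] ∃[ C₂ ] PappusConfiguration ℓ₁ ℓ₂ A₁ B₁ C₁ A₂ B₂ C₂
  parallel-case {ℓ₁} {ℓ₂} ≢ℓ σ≡τ {A} {B} A≢B A∈ℓ₁ B∈ℓ₁ with slope≡⇒Parallel ℓ₁ ℓ₂ σ≡τ
  ... | inj₁ ≡ℓ = contradiction ≡ℓ ≢ℓ
  ... | inj₂ disjoint = C , T , T +ᵥ (A -ᵥ B) , T +ᵥ (A -ᵥ C)
      , ≢ℓ
      , (A∈ℓ₁ , B∈ℓ₁ , C∈ℓ₁)
      , (T∈ℓ₂ , shifted B∈ℓ₁ , shifted C∈ℓ₁)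
      , (A≢B , A≢C , B≢C)
      , (A≢B ∘ T≢ B , A≢C ∘ T≢ C , λ e → B≢C (cancel (+ᵥ-cancelˡ T e)))
      , (disjoint A A∈ℓ₁ , disjoint B B∈ℓ₁ , disjoint C C∈ℓ₁)
      , ((λ ∈ → disjoint _ ∈ T∈ℓ₂) , (λ ∈ → disjoint _ ∈ (shifted B∈ℓ₁)) , (λ ∈ → disjoint _ ∈ (shifted C∈ℓ₁)))
      , Par⇒PappusCond
          (Par-≡ (coordinatewise₃ (λ t a b → solve 3 (λ t a b → t :+ (a :- b) :- a := t :- b) refl t a b) T A B))
          (Par-≡ (coordinatewise₃ (λ t a b → solve 3 (λ t a b → t :+ (a :- b) :- a := t :- b) refl t a b) T A C))
          (Par-≡ (coordinatewise₄ (λ t a b c → solve 4 (λ t a b c → t :+ (a :- c) :- b := t :+ (a :- b) :- c) refl t a b c) T A B C))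
    where
    c = proj₁ (independent (slope ℓ₁) (B -ᵥ A))
    c-Dir : Dir (slope ℓ₁) c
    c-Dir = proj₁ (proj₂ (independent (slope ℓ₁) (B -ᵥ A)))
    c-independent : ∀ k → c ≢ k ·ᵥ (B -ᵥ A)
    c-independent = proj₂ (proj₂ (independent (slope ℓ₁) (B -ᵥ A)))
    C = A +ᵥ c
    C∈ℓ₁ : C ∈L ℓ₁
    C∈ℓ₁ = translate-∈ ℓ₁ A∈ℓ₁ c-Dir
    C-A≡c : C -ᵥ A ≡ c
    C-A≡c = [O+v]-O≡v A c
    A≢C : A ≢ C
    A≢C e = c-independent 0# (trans (sym C-A≡c) (trans (cong (_-ᵥ A) (sym e))
      (trans (v-v≡0 A) (sym (0·ᵥ (B -ᵥ A))))))
    B≢C : B ≢ C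
    B≢C e = c-independent 1# (trans (sym C-A≡c) (trans (cong (_-ᵥ A) (sym e)) (sym (1·ᵥ (B -ᵥ A)))))
    T = proj₁ (point-on ℓ₂)
    T∈ℓ₂ : T ∈L ℓ₂
    T∈ℓ₂ = proj₂ (point-on ℓ₂)
    shifted : ∀ {X} → X ∈L ℓ₁ → (T +ᵥ (A -ᵥ X)) ∈L ℓ₂
    shifted X∈ℓ₁ = translate-∈ ℓ₂ T∈ℓ₂ (subst (λ σ → Dir σ _) σ≡τ (difference-Dir ℓ₁ X∈ℓ₁ A∈ℓ₁))
    T≢ : ∀ X → T ≡ T +ᵥ (A -ᵥ X) → A ≡ X
    T≢ X e = v-w≡0⇒v≡w (+ᵥ-cancelˡ T (trans (sym e) (sym (coordinatewise₁ +-identityʳ T))))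
    cancel : ∀ {X Y} → A -ᵥ X ≡ A -ᵥ Y → X ≡ Y
    cancel {X} {Y} e = trans (sym (double A X)) (trans (cong (A -ᵥ_) e) (double A Y))
      where double = coordinatewise₂ (λ a x → solve 2 (λ a x → a :- (a :- x) := x) refl a x)

  -- Configurations from two slopes with proportional maps.

  record Harmonic (σ τ : Slope) (γ : Carrier) : Set where
    field
      U U′ : Slope
      U≢σ : U ≢ σ
      partner : ∀ a → Dir σ a → ∃[ z ] (Dir τ z × Dir U (z -ᵥ a) × Dir U′ (z -ᵥ γ ·ᵥ a))

  module _ {σ τ γ} (γ≢0 : γ ≢ 0#) (γ≢1 : γ ≢ 1#) (G : Harmonic σ τ γ) where
    open Harmonic G

    -- The vector c b - a = (z - a) - c (w - b) lies in σ and in U, which meet only in 0. Taken with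
    -- c = 0, 1 and γ⁻¹ it shows that the points on the second line are nonzero and distinct.
    partner-proportional : ∀ {a b z w} → Dir σ a → Dir σ b → Dir U (z -ᵥ a) → Dir U (w -ᵥ b) →
      ∀ c → z ≡ c ·ᵥ w → a ≡ c ·ᵥ b
    partner-proportional {a} {b} {z} {w} da db dz dw c refl = sym (v-w≡0⇒v≡w (Dir-disjoint U≢σ
      (subst (Dir U) (coordinatewise₃ (λ w a b → solve 4 (λ c w a b → (c :* w :- a) :- c :* (w :- b) := c :* b :- a) refl c w a b) w a b)
        (Dir-- U dz (Dir-· U c dw)))
      (Dir-- σ (Dir-· σ c db) da)))

    -- For AB both difference vectors are of the form z - a and lie in U. For AC they are
    -- proportional, c′ - a = γ⁻¹ (a′ - c). For BC both lie in U′, as c′ - b = γ⁻¹ (a′ - γ b) and b′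
    -- - c = b′ - γ a.
    harmonic-Affine : ∀ {a b} → Dir σ a → Dir σ b → a ≢ 0ᵥ → b ≢ 0ᵥ → a ≢ b → b ≢ γ ·ᵥ a →
      ∃[ a′ ] ∃[ b′ ] ∃[ c′ ] Affine σ τ a b (γ ·ᵥ a) a′ b′ c′
    harmonic-Affine {a} {b} da db a≢0 b≢0 a≢b b≢γa with partner a da | partner b db
    ... | b′ , db′ , b′-a , b′-γa | a′ , da′ , a′-b , a′-γb = a′ , b′ , γ ⁻¹ ·ᵥ a′ , record
      { on = da , db , Dir-· σ γ da
      ; on′ = da′ , db′ , Dir-· τ (γ ⁻¹) da′
      ; nonzero = a≢0 , b≢0 , λ e → a≢0 (·ᵥ-≡0 γ≢0 e)
      ; nonzero′ = a′≢0 , b′≢0 , λ e → a′≢0 (·ᵥ-≡0 (⁻¹-≢0 γ≢0) e)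
      ; distinct = a≢b , (λ e → γ≢1 (sym (·ᵥ-cancelʳ a≢0 (trans (1·ᵥ a) e)))) , b≢γa
      ; distinct′ = (λ e → a≢b (sym (trans (partner-proportional db da a′-b b′-a 1# (trans e (sym (1·ᵥ b′)))) (1·ᵥ a))))
          , (λ e → γ≢1 (trans (sym (*-identityʳ γ)) (trans (cong (γ *_) (·ᵥ-cancelʳ a′≢0 (trans (1·ᵥ a′) e))) (⁻¹-inverse γ γ≢0))))
          , (λ e → b≢γa (trans (sym (unscale b)) (cong (γ ·ᵥ_) (sym (partner-proportional da db b′-a a′-b (γ ⁻¹) e)))))
      ; ab = U , b′-a , a′-b
      ; ac = Par-· (γ ⁻¹) (coordinatewise₂ (λ z a → modulo (⁻¹-inverse γ γ≢0) a
          (solve 4 (λ g i z a → i :* z :- a := i :* (z :- g :* a) :+ a :* (g :* i :- :1)) refl γ (γ ⁻¹) z a)) a′ a)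
      ; bc = U′ , subst (Dir U′) (coordinatewise₂ (λ z b → modulo (⁻¹-inverse γ γ≢0) (- b)
          (solve 4 (λ g i z b → i :* (z :- g :* b) := i :* z :- b :+ :- b :* (g :* i :- :1)) refl γ (γ ⁻¹) z b)) a′ b)
          (Dir-· U′ (γ ⁻¹) a′-γb) , b′-γa }
      where
      unscale : ∀ v → γ ·ᵥ γ ⁻¹ ·ᵥ v ≡ v
      unscale = coordinatewise₁ (λ x → modulo (⁻¹-inverse γ γ≢0) x
        (solve 3 (λ g i x → g :* (i :* x) := x :+ x :* (g :* i :- :1)) refl γ (γ ⁻¹) x))
      a′≢0 : a′ ≢ 0ᵥ
      a′≢0 e = b≢0 (trans (partner-proportional db da a′-b b′-a 0# (trans e (sym (0·ᵥ b′)))) (0·ᵥ a))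
      b′≢0 : b′ ≢ 0ᵥ
      b′≢0 e = a≢0 (trans (partner-proportional da db b′-a a′-b 0# (trans e (sym (0·ᵥ a′)))) (0·ᵥ b))

    harmonic-case : ∀ {a b} → Dir σ a → Dir σ b → a ≢ 0ᵥ → b ≢ 0ᵥ → a ≢ b → Completable σ τ a b
    harmonic-case {a} {b} da db a≢0 b≢0 a≢b with b ≟ᵥ (γ ·ᵥ a)
    ... | no b≢γa = γ ·ᵥ a , harmonic-Affine da db a≢0 b≢0 a≢b b≢γa
    -- The construction is run with an independent `c` in place of b; its third point γ a is then
    -- the given b, and `Affine-swap` restores the order.
    ... | yes refl =
      let (c , dc , c≢) = independent σ a
          (a′ , b′ , c′ , A) = harmonic-Affine da dc a≢0 (λ e → c≢ 0# (trans e (sym (0·ᵥ a))))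
            (λ e → c≢ 1# (trans (sym e) (sym (1·ᵥ a)))) (c≢ γ)
      in c , a′ , c′ , b′ , Affine-swap A

  -- Geometric progressions a, l a, l² a and z, l⁻¹ z, l⁻² z make the difference vectors of each
  -- pair scalar multiples of one another, so any slope τ and any nonzero z in it will do. The
  -- condition l² ≠ 1 keeps the first and third points apart.
  proportional-case : ∀ {σ τ a} l → l ≢ 0# → l ≢ 1# → l * l ≢ 1# → Dir σ a → a ≢ 0ᵥ → Completable σ τ a (l ·ᵥ a)
  proportional-case {σ} {τ} {a} l l≢0 l≢1 l²≢1 da a≢0 with nonzero-in τ
  ... | z , dz , z≢0 = (l * l) ·ᵥ a , z , i ·ᵥ z , (i * i) ·ᵥ z , record
    { on = da , Dir-· σ l da , Dir-· σ (l * l) da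
    ; on′ = dz , Dir-· τ i dz , Dir-· τ (i * i) dz
    ; nonzero = a≢0 , (λ e → a≢0 (·ᵥ-≡0 l≢0 e)) , λ e → a≢0 (·ᵥ-≡0 (*-≢0 l≢0 l≢0) e)
    ; nonzero′ = z≢0 , (λ e → z≢0 (·ᵥ-≡0 i≢0 e)) , λ e → z≢0 (·ᵥ-≡0 (*-≢0 i≢0 i≢0) e)
    ; distinct = (λ e → l≢1 (sym (·ᵥ-cancelʳ a≢0 (trans (1·ᵥ a) e)))) , (λ e → l²≢1 (sym (·ᵥ-cancelʳ a≢0 (trans (1·ᵥ a) e))))
        , λ e → l≢1 (sym (*-cancelˡ l≢0 (trans (*-identityʳ l) (·ᵥ-cancelʳ a≢0 e))))
    ; distinct′ = (λ e → l≢1 (sym (clear (·ᵥ-cancelʳ z≢0 (trans (1·ᵥ z) e))))) , (λ e → l²≢1 (sym (clear² (·ᵥ-cancelʳ z≢0 (trans (1·ᵥ z) e)))))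
        , λ e → l≢1 (sym (clear (*-cancelˡ i≢0 (trans (*-identityʳ i) (·ᵥ-cancelʳ z≢0 e)))))
    ; ab = Par-· i (coordinatewise₂ (λ z a → modulo l*i a
        (solve 4 (λ l i z a → i :* z :- a := i :* (z :- l :* a) :+ a :* (l :* i :- :1)) refl l i z a)) z a)
    ; ac = Par-· (i * i) (coordinatewise₂ (λ z a → modulo l*i (a * (l * i + 1#))
        (solve 4 (λ l i z a → i :* i :* z :- a := i :* i :* (z :- l :* l :* a) :+ a :* (l :* i :+ :1) :* (l :* i :- :1)) refl l i z a)) z a)
    ; bc = Par-· i (coordinatewise₂ (λ z a → modulo l*i (l * a)
        (solve 4 (λ l i z a → i :* i :* z :- l :* a := i :* (i :* z :- l :* l :* a) :+ l :* a :* (l :* i :- :1)) refl l i z a)) z a)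
    }
    where
    i = l ⁻¹
    l*i = ⁻¹-inverse l l≢0
    i≢0 = ⁻¹-≢0 l≢0
    clear : 1# ≡ i → 1# ≡ l
    clear e = trans (sym l*i) (trans (cong (l *_) (sym e)) (*-identityʳ l))
    clear² : 1# ≡ i * i → 1# ≡ l * l
    clear² e = modulo e (- (l * l)) (modulo l*i (- (l * i + 1#))
      (solve 2 (λ l i → :1 := l :* l :+ :- (l :* l) :* (:1 :- i :* i) :+ :- (l :* i :+ :1) :* (l :* i :- :1)) refl l i))

  -- Net slopes and pure tensors.

  Net : Slope → Set
  Net ∞       = ⊤
  Net (fin m) = proj₂ m ≡ 0#

  Net? : ∀ σ → Dec (Net σ)
  Net? ∞       = yes tt
  Net? (fin m) = proj₂ m ≟ 0#

  infix 20 _⊙_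
  -- The pure tensor of x and u under H × H = H ⊗ F².
  _⊙_ : H → H → Point
  x ⊙ u = (proj₁ u · x , proj₂ u · x)

  ⊙-Dir : ∀ u → ∃[ σ ] (∀ x → Dir σ (x ⊙ u))
  ⊙-Dir (u₀ , u₁) with u₀ ≟ 0#
  ... | yes refl = ∞ , λ x → pointwise₁ zeroˡ x
  ... | no u₀≢0 = fin (u₀ ⁻¹ * u₁ , 0#) , λ x → trans
    (pointwise₁ (λ x → modulo (⁻¹-inverse u₀ u₀≢0) (- (u₁ * x))
      (solve 4 (λ u v i x → v :* x := i :* v :* (u :* x) :+ :- (v :* x) :* (u :* i :- :1)) refl u₀ u₁ (u₀ ⁻¹) x)) x)
    (sym (⊗-scalar refl (u₀ · x)))

  Net-generator : ∀ σ → Net σ →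
    ∃[ u ] (u ≢ 0H × (∀ v → Dir σ v → ∃[ x ] v ≡ x ⊙ u) × (∀ x → Dir σ (x ⊙ u)))
  Net-generator ∞ _ = (0# , 1#) , (λ e → 1≢0 (cong proj₂ e)) ,
    (λ { (_ , y) refl → y , cong₂ _,_ (sym (pointwise₁ zeroˡ y)) (sym (pointwise₁ *-identityˡ y)) }) , pointwise₁ zeroˡ
  Net-generator (fin (c , _)) refl = (1# , c) , (λ e → 1≢0 (cong proj₁ e)) ,
    (λ { (x , _) refl → x , cong₂ _,_ (sym (pointwise₁ *-identityˡ x)) (⊗-scalar refl x) }) ,
    λ x → sym (trans (⊗-scalar refl (1# · x)) (cong (c ·_) (pointwise₁ *-identityˡ x)))

  -- If U were σ, then z = (z - a) + a would lie in both σ and τ.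
  transversal : ∀ {σ τ U a z} → σ ≢ τ → Dir σ a → Dir τ z → z ≢ 0ᵥ → Dir U (z -ᵥ a) → U ≢ σ
  transversal {σ} {a = a} {z} σ≢τ da dz z≢0 d refl = z≢0 (Dir-disjoint σ≢τ
    (subst (Dir σ) (coordinatewise₂ (λ z a → solve 2 (λ z a → z :- a :+ a := z) refl z a) z a) (Dir-+ σ d da)) dz)

  -- The partner of `x ⊙ u` is `x ⊙ w`: the difference x ⊙ w - γ (x ⊙ u) = x ⊙ (w - γ u) stays, for
  -- all x, in the net plane of w - γ u, whatever γ is.
  net-net : ∀ {σ τ} → σ ≢ τ → Net σ → Net τ → ∀ γ → Harmonic σ τ γ
  net-net {σ} {τ} σ≢τ nσ nτ γ with Net-generator σ nσ | Net-generator τ nτ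
  ... | u@(u₀ , u₁) , _ , generate , Dir-σ | w@(w₀ , w₁) , w≢0 , _ , Dir-τ = record
    { U = U ; U′ = U′
    ; U≢σ = transversal σ≢τ (Dir-σ (1# , 0#)) (Dir-τ (1# , 0#))
        (λ e → w≢0 (cong₂ _,_ (trans (sym (*-identityʳ w₀)) (cong (proj₁ ∘ proj₁) e))
                              (trans (sym (*-identityʳ w₁)) (cong (proj₁ ∘ proj₂) e))))
        (subst (Dir U) (sym (difference (1# , 0#))) (Dir-U (1# , 0#)))
    ; partner = λ a da → let (x , e) = generate a da in x ⊙ w , Dir-τ x ,
        subst (Dir U) (trans (sym (difference x)) (cong ((x ⊙ w) -ᵥ_) (sym e))) (Dir-U x) ,
        subst (Dir U′) (trans (sym (difference′ x)) (cong (λ a → (x ⊙ w) -ᵥ (γ ·ᵥ a)) (sym e))) (Dir-U′ x) }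
    where
    U = proj₁ (⊙-Dir (w ⊝ u))
    U′ = proj₁ (⊙-Dir (w ⊝ (γ · u)))
    Dir-U : ∀ x → Dir U (x ⊙ (w ⊝ u))
    Dir-U = proj₂ (⊙-Dir (w ⊝ u))
    Dir-U′ : ∀ x → Dir U′ (x ⊙ (w ⊝ (γ · u)))
    Dir-U′ = proj₂ (⊙-Dir (w ⊝ (γ · u)))
    difference : ∀ x → (x ⊙ w) -ᵥ (x ⊙ u) ≡ x ⊙ (w ⊝ u)
    difference x = cong₂ _,_ (part w₀ u₀) (part w₁ u₁)
      where part = λ w u → pointwise₁ (λ x → solve 3 (λ w u x → w :* x :- u :* x := (w :- u) :* x) refl w u x) x
    difference′ : ∀ x → (x ⊙ w) -ᵥ (γ ·ᵥ (x ⊙ u)) ≡ x ⊙ (w ⊝ (γ · u))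
    difference′ x = cong₂ _,_ (part w₀ u₀) (part w₁ u₁)
      where part = λ w u → pointwise₁ (λ x →
                     solve 4 (λ c w u x → w :* x :- c :* (u :* x) := (w :- c :* u) :* x) refl γ w u x) x

  -- Non-net slopes as lines over F(θ).

  -- Multiplication by θ on H ⊗ F(θ) = H × H, with θ a root of f; its invariant slopes are the non-net ones.
  θ· : Point → Point
  θ· (x , y) = (y , (r · y) ⊕ (s · x))

  [_+_θ]_ : Carrier → Carrier → Point → Point
  [ α + β θ] v = α ·ᵥ v +ᵥ β ·ᵥ θ· v

  -- By `⊗-square`, θ sends (x , x ⊗ m) to (x ⊗ m , (x ⊗ m) ⊗ m), which is again of slope m.
  θ-Dir : ∀ {m} → proj₂ m ≢ 0# → ∀ {v} → Dir (fin m) v → ∀ α β → Dir (fin m) ([ α + β θ] v)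
  θ-Dir {m} m₂≢0 {x , _} refl α β = Dir-combination (fin m) α β refl (sym (⊗-square m₂≢0 x))

  -- A quadratic form on F⁴ that vanishes exactly on the pure tensors, that is, on the union of the
  -- net planes.
  detᵥ : Point → Carrier
  detᵥ (x , y) = det x y

  -- A nonzero `detᵥ` excludes every net slope, and the remaining slopes are invariant under θ.
  detᵥ≢0⇒θ-Dir : ∀ σ {v} → detᵥ v ≢ 0# → Dir σ v → ∀ α β → Dir σ ([ α + β θ] v)
  detᵥ≢0⇒θ-Dir ∞ {_ , y₁ , y₂} D≢0 refl = contradiction (solve 2 (λ a b → :0 :* b :- :0 :* a := :0) refl y₁ y₂) D≢0
  detᵥ≢0⇒θ-Dir (fin m) {x , _} D≢0 refl = θ-Dir (λ m₂≡0 → D≢0 (trans (cong (det x) (⊗-scalar m₂≡0 x))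
    (solve 3 (λ a b c → a :* (c :* b) :- b :* (c :* a) := :0) refl (proj₁ x) (proj₂ x) (proj₁ m)))) refl

  Dir⇒detᵥ≢0 : ∀ {m} → proj₂ m ≢ 0# → ∀ {v} → Dir (fin m) v → v ≢ 0ᵥ → detᵥ v ≢ 0#
  Dir⇒detᵥ≢0 {m} m₂≢0 {x , _} refl v≢0 = det-⊗≢0 m₂≢0 λ { refl → v≢0 (cong (0H ,_) (0⊗ m)) }

  detᵥ≢0⇒≢0 : ∀ {v} → detᵥ v ≢ 0# → v ≢ 0ᵥ
  detᵥ≢0⇒≢0 D≢0 refl = D≢0 (solve 0 (:0 :* :0 :- :0 :* :0 := :0) refl)

  θ-span : ∀ {m} → proj₂ m ≢ 0# → ∀ {v} → Dir (fin m) v → v ≢ 0ᵥ → ∀ a → Dir (fin m) a →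
    ∃[ α ] ∃[ β ] a ≡ [ α + β θ] v
  θ-span {m} m₂≢0 {v} d v≢0 (x , _) refl =
    let (α , β , e) = det≢0⇒basis (Dir⇒detᵥ≢0 m₂≢0 {v} d v≢0) x
    in α , β , cong₂ _,_ e (trans (cong (_⊗ m) e) (sym (θ-Dir m₂≢0 {v} d α β)))

  θ-difference : ∀ α β c v w → ([ α + β θ] w) -ᵥ c ·ᵥ ([ α + β θ] v) ≡ [ α + β θ] (w -ᵥ c ·ᵥ v)
  θ-difference α β c ((v₁ , v₂) , (v₃ , v₄)) ((w₁ , w₂) , (w₃ , w₄)) =
    cong₂ _,_ (cong₂ _,_ (e v₁ v₃ w₁ w₃) (e v₂ v₄ w₂ w₄)) (cong₂ _,_ (e′ v₁ v₃ w₁ w₃) (e′ v₂ v₄ w₂ w₄))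
    where
    e : ∀ v v′ w w′ → α * w + β * w′ - c * (α * v + β * v′) ≡ α * (w - c * v) + β * (w′ - c * v′)
    e = solve 7 (λ α β c v v′ w w′ →
      α :* w :+ β :* w′ :- c :* (α :* v :+ β :* v′) := α :* (w :- c :* v) :+ β :* (w′ :- c :* v′)) refl α β c
    e′ : ∀ v v′ w w′ → α * w′ + β * (r * w′ + s * w) - c * (α * v′ + β * (r * v′ + s * v))
                     ≡ α * (w′ - c * v′) + β * (r * (w′ - c * v′) + s * (w - c * v))
    e′ = solve 9 (λ r s α β c v v′ w w′ →
      α :* w′ :+ β :* (r :* w′ :+ s :* w) :- c :* (α :* v′ :+ β :* (r :* v′ :+ s :* v))
      := α :* (w′ :- c :* v′) :+ β :* (r :* (w′ :- c :* v′) :+ s :* (w :- c :* v))) refl r s α β c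

  detᵥ-θ : ∀ α β v → detᵥ ([ α + β θ] v) ≡ N α β * detᵥ v
  detᵥ-θ α β ((v₁ , v₂) , (v₃ , v₄)) = solve 8 (λ r s α β v₁ v₂ v₃ v₄ →
    (α :* v₁ :+ β :* v₃) :* (α :* v₄ :+ β :* (r :* v₄ :+ s :* v₂))
      :- (α :* v₂ :+ β :* v₄) :* (α :* v₃ :+ β :* (r :* v₃ :+ s :* v₁))
    := (α :* α :+ r :* α :* β :- s :* β :* β) :* (v₁ :* v₄ :- v₂ :* v₃)) refl r s α β v₁ v₂ v₃ v₄

  -- The bilinear form detᵥ (v + w) - detᵥ v - detᵥ w.
  polar : Point → Point → Carrier
  polar (x , y) (x′ , y′) = det x y′ + det x′ y

  detᵥ-difference : ∀ c v w → detᵥ (w -ᵥ c ·ᵥ v) ≡ detᵥ w - c * polar v w + c * c * detᵥ v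
  detᵥ-difference c ((v₁ , v₂) , (v₃ , v₄)) ((w₁ , w₂) , (w₃ , w₄)) = solve 9 (λ c v₁ v₂ v₃ v₄ w₁ w₂ w₃ w₄ →
    (w₁ :- c :* v₁) :* (w₄ :- c :* v₄) :- (w₂ :- c :* v₂) :* (w₃ :- c :* v₃)
    := w₁ :* w₄ :- w₂ :* w₃ :- c :* ((v₁ :* w₄ :- v₂ :* w₃) :+ (w₁ :* v₄ :- w₂ :* v₃)) :+ c :* c :* (v₁ :* v₄ :- v₂ :* v₃))
    refl c v₁ v₂ v₃ v₄ w₁ w₂ w₃ w₄

  polar-θ : ∀ α β v w → polar v ([ α + β θ] w) ≡ α * polar v w + β * polar v (θ· w)
  polar-θ α β ((v₁ , v₂) , (v₃ , v₄)) ((w₁ , w₂) , (w₃ , w₄)) = solve 12 (λ r s α β v₁ v₂ v₃ v₄ w₁ w₂ w₃ w₄ →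
    (v₁ :* (α :* w₄ :+ β :* (r :* w₄ :+ s :* w₂)) :- v₂ :* (α :* w₃ :+ β :* (r :* w₃ :+ s :* w₁)))
      :+ ((α :* w₁ :+ β :* w₃) :* v₄ :- (α :* w₂ :+ β :* w₄) :* v₃)
    := α :* ((v₁ :* w₄ :- v₂ :* w₃) :+ (w₁ :* v₄ :- w₂ :* v₃))
      :+ β :* ((v₁ :* (r :* w₄ :+ s :* w₂) :- v₂ :* (r :* w₃ :+ s :* w₁)) :+ (w₃ :* v₄ :- w₄ :* v₃)))
    refl r s α β v₁ v₂ v₃ v₄ w₁ w₂ w₃ w₄

  -- Generators v and w of σ and τ over F(θ) for which w - v and w - γ v both have non-net slope.
  -- The factor `1#` gives the two conditions the same shape.
  Transverse : Slope → Slope → Carrier → Set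
  Transverse σ τ γ = ∃[ v ] ∃[ w ] (Dir σ v × Dir τ w × v ≢ 0ᵥ × w ≢ 0ᵥ ×
    detᵥ (w -ᵥ 1# ·ᵥ v) ≢ 0# × detᵥ (w -ᵥ γ ·ᵥ v) ≢ 0#)

  -- The partner map is the F(θ)-linear map taking v to w. Differences are then F(θ)-multiples of w
  -- - v and w - γ v, and these stay in one slope because it is non-net.
  Transverse⇒Harmonic : ∀ {m n γ} → fin m ≢ fin n → proj₂ m ≢ 0# → proj₂ n ≢ 0# →
    Transverse (fin m) (fin n) γ → Harmonic (fin m) (fin n) γ
  Transverse⇒Harmonic {m} {n} {γ} σ≢τ m₂≢0 n₂≢0 (v , w , dv , dw , v≢0 , w≢0 , D≢0 , D′≢0) = record
    { U = U ; U′ = U′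
    ; U≢σ = transversal {a = v} {w} σ≢τ dv dw w≢0
        (subst (Dir U) (cong (w -ᵥ_) (1·ᵥ v)) (proj₂ (Dir-exists (w -ᵥ 1# ·ᵥ v))))
    ; partner = λ a da → let (α , β , e) = θ-span m₂≢0 {v} dv v≢0 a da in [ α + β θ] w , θ-Dir n₂≢0 {w} dw α β ,
        subst (Dir U) (trans (sym (θ-difference α β 1# v w)) (cong (([ α + β θ] w) -ᵥ_) (trans (1·ᵥ _) (sym e))))
          (detᵥ≢0⇒θ-Dir U D≢0 (proj₂ (Dir-exists (w -ᵥ 1# ·ᵥ v))) α β) ,
        subst (Dir U′) (trans (sym (θ-difference α β γ v w)) (cong (λ a → ([ α + β θ] w) -ᵥ γ ·ᵥ a) (sym e)))
          (detᵥ≢0⇒θ-Dir U′ D′≢0 (proj₂ (Dir-exists (w -ᵥ γ ·ᵥ v))) α β) }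
    where
    U  = proj₁ (Dir-exists (w -ᵥ 1# ·ᵥ v))
    U′ = proj₁ (Dir-exists (w -ᵥ γ ·ᵥ v))

  -- `polar v` is a linear functional on a plane spanned by w and θ w, so it kills a nonzero vector
  -- there, namely b′ w - b θ w. Its `detᵥ` is a nonzero norm times that of w.
  orthogonal : ∀ {n} → proj₂ n ≢ 0# → ∀ v → ∃[ w ] (Dir (fin n) w × detᵥ w ≢ 0# × polar v w ≡ 0#)
  orthogonal {n} n₂≢0 v with nonzero-in (fin n)
  ... | w , dw , w≢0 with polar v w ≟ 0#
  ...   | yes e = w , dw , Dir⇒detᵥ≢0 n₂≢0 dw w≢0 , e
  ...   | no b≢0 = [ b′ + - b θ] w , θ-Dir n₂≢0 {w} dw b′ (- b) ,
    (λ e → *-≢0 (N≢0ʳ (λ e → b≢0 (-x≡0⇒x≡0 e))) (Dir⇒detᵥ≢0 n₂≢0 {w} dw w≢0) (trans (sym (detᵥ-θ b′ (- b) w)) e)) ,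
    trans (polar-θ b′ (- b) v w) (solve 2 (λ b b′ → b′ :* b :+ :- b :* b′ := :0) refl b b′)
    where b = polar v w
          b′ = polar v (θ· w)

  detᵥ-· : ∀ c v → detᵥ (c ·ᵥ v) ≡ c * c * detᵥ v
  detᵥ-· c ((v₁ , v₂) , (v₃ , v₄)) = solve 5 (λ c v₁ v₂ v₃ v₄ →
    c :* v₁ :* (c :* v₄) :- c :* v₂ :* (c :* v₃) := c :* c :* (v₁ :* v₄ :- v₂ :* v₃)) refl c v₁ v₂ v₃ v₄

  polar-· : ∀ c v w → polar v w ≡ 0# → polar (c ·ᵥ v) w ≡ 0# × polar v (c ·ᵥ w) ≡ 0#
  polar-· c ((v₁ , v₂) , (v₃ , v₄)) ((w₁ , w₂) , (w₃ , w₄)) e =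
    modulo e c (solve 9 (λ c v₁ v₂ v₃ v₄ w₁ w₂ w₃ w₄ →
      (c :* v₁ :* w₄ :- c :* v₂ :* w₃) :+ (w₁ :* (c :* v₄) :- w₂ :* (c :* v₃))
      := :0 :+ c :* ((v₁ :* w₄ :- v₂ :* w₃) :+ (w₁ :* v₄ :- w₂ :* v₃) :- :0)) refl c v₁ v₂ v₃ v₄ w₁ w₂ w₃ w₄) ,
    modulo e c (solve 9 (λ c v₁ v₂ v₃ v₄ w₁ w₂ w₃ w₄ →
      (v₁ :* (c :* w₄) :- v₂ :* (c :* w₃)) :+ (c :* w₁ :* v₄ :- c :* w₂ :* v₃)
      := :0 :+ c :* ((v₁ :* w₄ :- v₂ :* w₃) :+ (w₁ :* v₄ :- w₂ :* v₃) :- :0)) refl c v₁ v₂ v₃ v₄ w₁ w₂ w₃ w₄)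

  nonzero-·ᵥ : ∀ {c v} → c ≢ 0# → v ≢ 0ᵥ → c ·ᵥ v ≢ 0ᵥ
  nonzero-·ᵥ c≢0 v≢0 e = v≢0 (·ᵥ-≡0 c≢0 e)

  -- For v orthogonal to w, detᵥ (w - c v) = d′ + c² d. Should this vanish at c = 1, rescaling v by
  -- γ turns the two values into d (γ² - 1) and d (γ⁴ - 1). Should it vanish only at c = γ,
  -- rescaling w by γ gives d (1 - γ⁴) and γ² (d′ + d).
  nonnet-nonnet-generic : ∀ {m n} → proj₂ m ≢ 0# → proj₂ n ≢ 0# → ∀ {γ} → γ ≢ 0# →
    γ * γ ≢ 1# → γ * γ * (γ * γ) ≢ 1# → Transverse (fin m) (fin n) γ
  nonnet-nonnet-generic {m} {n} m₂≢0 n₂≢0 {γ} γ≢0 γ²≢1 γ⁴≢1 with nonzero-in (fin m)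
  ... | v , dv , v≢0 with orthogonal n₂≢0 v
  ... | w , dw , d′≢0 , v⊥w = cases ((d′ + d) ≟ 0#) ((d′ + γ * γ * d) ≟ 0#)
    where
    d = detᵥ v
    d′ = detᵥ w
    d≢0 : d ≢ 0#
    d≢0 = Dir⇒detᵥ≢0 m₂≢0 {v} dv v≢0
    w≢0 : w ≢ 0ᵥ
    w≢0 = detᵥ≢0⇒≢0 {w} d′≢0
    orthogonal-difference : ∀ c v w {d d′} → polar v w ≡ 0# → detᵥ v ≡ d → detᵥ w ≡ d′ →
      detᵥ (w -ᵥ c ·ᵥ v) ≡ d′ + c * c * d
    orthogonal-difference c v w {d} {d′} v⊥w refl refl = trans (detᵥ-difference c v w) (trans (cong (λ b → d′ - c * b + c * c * d) v⊥w)
      (solve 3 (λ c d d′ → d′ :- c :* :0 :+ c :* c :* d := d′ :+ c :* c :* d) refl c d d′))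
    cases : Dec (d′ + d ≡ 0#) → Dec (d′ + γ * γ * d ≡ 0#) → Transverse (fin m) (fin n) γ
    cases (yes e) _ = γ ·ᵥ v , w , Dir-· (fin m) {v} γ dv , dw , nonzero-·ᵥ γ≢0 v≢0 , w≢0 ,
      (λ e′ → *-≢0 d≢0 (λ k → γ²≢1 (x-y≡0⇒x≡y k)) (modulo e (- 1#) (modulo (trans (sym (difference 1#)) e′) 1#
        (solve 3 (λ g d d′ → d :* (g :* g :- :1) := :0 :+ :- :1 :* (d′ :+ d :- :0) :+ :1 :* (d′ :+ :1 :* :1 :* (g :* g :* d) :- :0))
          refl γ d d′)))) ,
      (λ e′ → *-≢0 d≢0 (λ k → γ⁴≢1 (x-y≡0⇒x≡y k)) (modulo e (- 1#) (modulo (trans (sym (difference γ)) e′) 1#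
        (solve 3 (λ g d d′ → d :* (g :* g :* (g :* g) :- :1) := :0 :+ :- :1 :* (d′ :+ d :- :0) :+ :1 :* (d′ :+ g :* g :* (g :* g :* d) :- :0))
          refl γ d d′))))
      where
      difference : ∀ c → detᵥ (w -ᵥ c ·ᵥ γ ·ᵥ v) ≡ d′ + c * c * (γ * γ * d)
      difference c = orthogonal-difference c (γ ·ᵥ v) w (proj₁ (polar-· γ v w v⊥w)) (detᵥ-· γ v) refl
    cases (no d′+d≢0) (yes e) = v , γ ·ᵥ w , dv , Dir-· (fin n) {w} γ dw , v≢0 , nonzero-·ᵥ γ≢0 w≢0 ,
      (λ e′ → *-≢0 d≢0 (λ k → γ⁴≢1 (x-y≡0⇒x≡y k)) (modulo e (γ * γ) (modulo (trans (sym (difference 1#)) e′) (- 1#)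
        (solve 3 (λ g d d′ → d :* (g :* g :* (g :* g) :- :1)
          := :0 :+ g :* g :* (d′ :+ g :* g :* d :- :0) :+ :- :1 :* (g :* g :* d′ :+ :1 :* :1 :* d :- :0)) refl γ d d′)))) ,
      (λ e′ → *-≢0 (*-≢0 γ≢0 γ≢0) d′+d≢0 (modulo (trans (sym (difference γ)) e′) 1#
        (solve 3 (λ g d d′ → g :* g :* (d′ :+ d) := :0 :+ :1 :* (g :* g :* d′ :+ g :* g :* d :- :0)) refl γ d d′)))
      where
      difference : ∀ c → detᵥ ((γ ·ᵥ w) -ᵥ c ·ᵥ v) ≡ γ * γ * d′ + c * c * d
      difference c = orthogonal-difference c v (γ ·ᵥ w) (proj₂ (polar-· γ v w v⊥w)) refl (detᵥ-· γ w)
    cases (no d′+d≢0) (no d′+γ²d≢0) = v , w , dv , dw , v≢0 , w≢0 ,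
      (λ e → d′+d≢0 (trans (solve 2 (λ d d′ → d′ :+ d := d′ :+ :1 :* :1 :* d) refl d d′)
        (trans (sym (orthogonal-difference 1# v w v⊥w refl refl)) e))) ,
      (λ e → d′+γ²d≢0 (trans (sym (orthogonal-difference γ v w v⊥w refl refl)) e))

  -- Two non-net slopes in odd characteristic.

  module OddCharacteristic (2≢0 : 1# + 1# ≢ 0#) where
    h : Carrier
    h = (1# + 1#) ⁻¹

    2h≡1 : (1# + 1#) * h ≡ 1#
    2h≡1 = ⁻¹-inverse (1# + 1#) 2≢0

    -1≢1 : - 1# ≢ 1#
    -1≢1 e = 2≢0 (modulo e (- 1#) (solve 0 (:1 :+ :1 := :0 :+ :- :1 :* (:- :1 :- :1)) refl))

    -- The second difference N(1 + θ) - 2 N(θ) + N(-1 + θ) equals 2, so the three norms cannot all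
    -- be 1.
    norm≢1 : ∃[ α ] N α 1# ≢ 1#
    norm≢1 with N 0# 1# ≟ 1# | N 1# 1# ≟ 1# | N (- 1#) 1# ≟ 1#
    ... | no n≢1 | _ | _ = 0# , n≢1
    ... | yes _ | no n≢1 | _ = 1# , n≢1
    ... | yes _ | yes _ | no n≢1 = - 1# , n≢1
    ... | yes e₀ | yes e₁ | yes e₂ = contradiction
      (modulo e₀ (- (1# + 1#)) (modulo e₁ 1# (modulo e₂ 1# (solve 2 (λ r s →
        let n = λ α → α :* α :+ r :* α :* :1 :- s :* :1 :* :1 in
        :1 :+ :1 := :0 :+ :- (:1 :+ :1) :* (n :0 :- :1) :+ :1 :* (n :1 :- :1) :+ :1 :* (n (:- :1) :- :1)) refl r s)))) 2≢0

    -- Here r - 2c is the coefficient of θ in (c - θ)², which has to be nonzero in `norm≡1`.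
    r≢2λ : ∃[ c ] (r - (c + c)) ≢ 0#
    r≢2λ with r ≟ 0#
    ... | no r≢0 = 0# , λ e → r≢0 (modulo e 1# (solve 1 (λ r → r := :0 :+ :1 :* (r :- (:0 :+ :0) :- :0)) refl r))
    ... | yes r≡0 = 1# , λ e → 2≢0 (modulo e (- 1#) (modulo r≡0 1#
      (solve 1 (λ r → :1 :+ :1 := :0 :+ :- :1 :* (r :- (:1 :+ :1) :- :0) :+ :1 :* (r :- :0)) refl r)))

    -- (c − θ)² / N(c − θ) has norm 1.
    norm≡1 : ∃[ α ] ∃[ β ] (β ≢ 0# × N α β ≡ 1#)
    norm≡1 = let (c , ≢0) = r≢2λ ; g = f c ; i = g ⁻¹ in
      i * (s + c * c) , i * (r - (c + c)) , *-≢0 (⁻¹-≢0 (f≢0 c)) ≢0 ,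
      modulo (⁻¹-inverse g (f≢0 c)) (g * i + 1#) (solve 4 (λ r s c i →
        let α = i :* (s :+ c :* c) ; β = i :* (r :- (c :+ c)) in
        α :* α :+ r :* α :* β :- s :* β :* β := :1 :+ (:f r s c :* i :+ :1) :* (:f r s c :* i :- :1)) refl r s c i)

    -- For γ = -1 and v orthogonal to w, both values of `detᵥ` are d′ + d, and rescaling by γ
    -- changes nothing. If d′ = - d, then w is multiplied by α + β θ, and the values become d (1 - N
    -- α β) ∓ β e. With e = 0 a norm other than 1 makes them nonzero; with e ≠ 0 a norm equal to 1
    -- with β ≠ 0 does.
    nonnet-nonnet : ∀ {m n} → proj₂ m ≢ 0# → proj₂ n ≢ 0# → Transverse (fin m) (fin n) (- 1#)
    nonnet-nonnet {m} {n} m₂≢0 n₂≢0 with nonzero-in (fin m)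
    ... | v , dv , v≢0 with orthogonal n₂≢0 v
    ... | w , dw , d′≢0 , v⊥w = cases ((d′ + d) ≟ 0#) (e ≟ 0#)
      where
      d = detᵥ v
      d′ = detᵥ w
      e = polar v (θ· w)
      d≢0 : d ≢ 0#
      d≢0 = Dir⇒detᵥ≢0 m₂≢0 {v} dv v≢0
      choose : ∀ α β → N α β ≢ 0# → (∀ c → c * c ≡ 1# → N α β * d′ - c * (β * e) + d ≢ 0#) →
        Transverse (fin m) (fin n) (- 1#)
      choose α β n≢0 ≢0 = v , [ α + β θ] w , dv , θ-Dir n₂≢0 {w} dw α β , v≢0 ,
        detᵥ≢0⇒≢0 {[ α + β θ] w} (λ e → *-≢0 n≢0 d′≢0 (trans (sym (detᵥ-θ α β w)) e)) ,
        apart 1# (*-identityˡ 1#) , apart (- 1#) (solve 0 (:- :1 :* :- :1 := :1) refl)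
        where
        apart : ∀ c → c * c ≡ 1# → detᵥ ([ α + β θ] w -ᵥ c ·ᵥ v) ≢ 0#
        apart c c²≡1 e₀ = ≢0 c c²≡1 (modulo (trans (sym (detᵥ-difference c v ([ α + β θ] w))) e₀) 1#
          (modulo (detᵥ-θ α β w) (- 1#) (modulo (trans (polar-θ α β v w) (cong (λ b → α * b + β * e) v⊥w)) c (modulo c²≡1 (- d)
            (solve 9 (λ n d′ c α β e d D B → n :* d′ :- c :* (β :* e) :+ d
              := :0 :+ :1 :* (D :- c :* B :+ c :* c :* d :- :0) :+ :- :1 :* (D :- n :* d′)
                :+ c :* (B :- (α :* :0 :+ β :* e)) :+ :- d :* (c :* c :- :1))
              refl (N α β) d′ c α β e d (detᵥ ([ α + β θ] w)) (polar v ([ α + β θ] w)))))))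
      cases : Dec (d′ + d ≡ 0#) → Dec (e ≡ 0#) → Transverse (fin m) (fin n) (- 1#)
      cases (no d′+d≢0) _ = choose 1# 0# (N≢0 (inj₁ 1≢0)) λ c _ e₀ → d′+d≢0 (modulo e₀ 1#
        (solve 6 (λ r s c e d d′ → d′ :+ d := :0 :+ :1 :*
            ((:1 :* :1 :+ r :* :1 :* :0 :- s :* :0 :* :0) :* d′ :- c :* (:0 :* e) :+ d :- :0)) refl r s c e d d′))
      cases (yes d′+d≡0) (yes e≡0) = let (α , n≢1) = norm≢1 ; n = N α 1# in
        choose α 1# (N≢0ʳ 1≢0) λ c _ e₀ → *-≢0 d≢0 (λ k → n≢1 (x-y≡0⇒x≡y k)) (modulo e₀ (- 1#) (modulo d′+d≡0 n (modulo e≡0 (- c)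
          (solve 5 (λ n c e d d′ → d :* (n :- :1)
            := :0 :+ :- :1 :* (n :* d′ :- c :* (:1 :* e) :+ d :- :0) :+ n :* (d′ :+ d :- :0) :+ :- c :* (e :- :0)) refl n c e d d′))))
      cases (yes d′+d≡0) (no e≢0) = let (α , β , β≢0 , n≡1) = norm≡1 ; n = N α β in
        choose α β (N≢0ʳ β≢0) λ c c²≡1 e₀ → *-≢0 β≢0 e≢0 (modulo e₀ (- c) (modulo d′+d≡0 (c * n) (modulo n≡1 (- (c * d)) (modulo c²≡1 (- (β * e))
          (solve 6 (λ n c β e d d′ → β :* e
            := :0 :+ :- c :* (n :* d′ :- c :* (β :* e) :+ d :- :0) :+ c :* n :* (d′ :+ d :- :0)
               :+ :- (c :* d) :* (n :- :1) :+ :- (β :* e) :* (c :* c :- :1)) refl n c β e d d′)))))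

  -- A net and a non-net slope in odd characteristic.

  -- The operator α + β m is inverted by its conjugate α + r β - β m divided by the norm.
  ⊗-combination-surjective : ∀ {m} → proj₂ m ≢ 0# → ∀ {α β} → α ≢ 0# ⊎ β ≢ 0# →
    ∀ x → ∃[ t ] x ≡ (α · t) ⊕ (β · (t ⊗ m))
  ⊗-combination-surjective {m} m₂≢0 {α} {β} ≢0 x = t , sym (trans
    (cong (λ p → (α · t) ⊕ (β · p)) (trans (⊗-linear m _ x _ (x ⊗ m)) (cong (λ z → ((i * (α + r * β)) · (x ⊗ m)) ⊕ ((- (i * β)) · z)) (⊗-square m₂≢0 x))))
    (pointwise₂ (λ x p → modulo (⁻¹-inverse (N α β) (N≢0 ≢0)) x (solve 7 (λ r s α β i x p →
      α :* (i :* (α :+ r :* β) :* x :+ :- (i :* β) :* p) :+ β :* (i :* (α :+ r :* β) :* p :+ :- (i :* β) :* (r :* p :+ s :* x))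
      := x :+ x :* ((α :* α :+ r :* α :* β :- s :* β :* β) :* i :- :1)) refl r s α β i x p)) x (x ⊗ m)))
    where
    i = N α β ⁻¹
    t = ((i * (α + r * β)) · x) ⊕ ((- (i * β)) · (x ⊗ m))

  module _ {u₀ u₁ : Carrier} {m : H} {σ : Slope} (u≢0 : (u₀ , u₁) ≢ 0H) (m₂≢0 : proj₂ m ≢ 0#) (generate : ∀ v → Dir σ v → ∃[ x ] v ≡ x ⊙ (u₀ , u₁))
           (Dir-σ : ∀ x → Dir σ (x ⊙ (u₀ , u₁))) (netσ : Net σ) (2≢0 : 1# + 1# ≢ 0#) where
    open OddCharacteristic 2≢0

    -- The slopes σ, fin m, U, U′ form a harmonic quadruple, with U the conjugate of fin m.
    private
      U U′ : Slope
      U = fin (conjugate m)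
      u′ : H
      u′ = (u₁ - h * u₀ * r , h * u₁ * r + u₀ * s)
      U′ = proj₁ (⊙-Dir u′)

      -- Write m̄ = r - m. Then (m - m̄) u = (u₁ - u₀ m̄)(1 , m) - (u₁ - u₀ m)(1 , m̄) splits the
      -- net vector into parts of slopes m and m̄, and `nonnet` is the first part. Twice `nonnet`
      -- minus `net` is the sum of the two parts without the sign; it is symmetric in m and m̄, so
      -- its coefficients are scalars. Hence U′ is a net slope and the factor is 1/2.
      net nonnet : H → Point
      net t = (((- r) · t) ⊕ ((1# + 1#) · (t ⊗ m))) ⊙ (u₀ , u₁)
      nonnet t = (((u₁ - u₀ * r) · t) ⊕ (u₀ · (t ⊗ m)) , (u₁ · (t ⊗ m)) ⊕ ((u₀ * s) · t))

      nonnet-Dir : ∀ t → Dir (fin m) (nonnet t)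
      nonnet-Dir t = sym (trans (⊗-linear m _ t u₀ (t ⊗ m)) (trans
        (cong (λ z → ((u₁ - u₀ * r) · (t ⊗ m)) ⊕ (u₀ · z)) (⊗-square m₂≢0 t))
        (pointwise₂ (λ t p → solve 6 (λ r s u v t p →
          (v :- u :* r) :* p :+ u :* (r :* p :+ s :* t) := v :* p :+ u :* s :* t) refl r s u₀ u₁ t p) t (t ⊗ m))))

      Dir-U : ∀ t → Dir U (nonnet t -ᵥ net t)
      Dir-U t = sym (begin
        d ⊗ conjugate m                                                      ≡⟨ ⊗-conjugate m₂≢0 d ⟩
        (r · d) ⊝ (d ⊗ m)                                                    ≡⟨ cong (λ d → (r · d) ⊝ (d ⊗ m)) d≡ ⟩
        (r · d′) ⊝ (d′ ⊗ m)                                                  ≡⟨ cong ((r · d′) ⊝_) (⊗-linear m u₁ t (- u₀) p) ⟩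
        (r · d′) ⊝ ((u₁ · p) ⊕ ((- u₀) · (p ⊗ m)))                           ≡⟨ cong (λ z → (r · d′) ⊝ ((u₁ · p) ⊕ ((- u₀) · z))) (⊗-square m₂≢0 t) ⟩
        (r · d′) ⊝ ((u₁ · p) ⊕ ((- u₀) · ((r · p) ⊕ (s · t))))               ≡⟨ pointwise₂ (λ t p → solve 6 (λ r s u v t p →
            r :* (v :* t :+ :- u :* p) :- (v :* p :+ :- u :* (r :* p :+ s :* t))
            := v :* p :+ u :* s :* t :- v :* (:- r :* t :+ (:1 :+ :1) :* p)) refl r s u₀ u₁ t p) t p ⟩
        proj₂ (nonnet t -ᵥ net t)                                            ∎)
        where
        open ≡-Reasoning
        p = t ⊗ m
        d = proj₁ (nonnet t -ᵥ net t)
        d′ = (u₁ · t) ⊕ ((- u₀) · p)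
        d≡ : d ≡ d′
        d≡ = pointwise₂ (λ t p → solve 5 (λ r u v t p →
          (v :- u :* r) :* t :+ u :* p :- u :* (:- r :* t :+ (:1 :+ :1) :* p) := v :* t :+ :- u :* p) refl r u₀ u₁ t p) t p

      Dir-U′ : ∀ t → Dir U′ (nonnet t -ᵥ h ·ᵥ net t)
      Dir-U′ t = subst (Dir U′) (sym (cong₂ _,_
        (pointwise₂ (λ t p → modulo 2h≡1 (u₀ * (r * t - p)) (solve 6 (λ r h u v t p →
          (v :- u :* r) :* t :+ u :* p :- h :* (u :* (:- r :* t :+ (:1 :+ :1) :* p))
          := (v :- h :* u :* r) :* t :+ u :* (r :* t :- p) :* ((:1 :+ :1) :* h :- :1)) refl r h u₀ u₁ t p)) t (t ⊗ m))
        (pointwise₂ (λ t p → modulo 2h≡1 (- (u₁ * p)) (solve 7 (λ r s h u v t p →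
          v :* p :+ u :* s :* t :- h :* (v :* (:- r :* t :+ (:1 :+ :1) :* p))
          := (h :* v :* r :+ u :* s) :* t :+ :- (v :* p) :* ((:1 :+ :1) :* h :- :1)) refl r s h u₀ u₁ t p)) t (t ⊗ m))))
        (proj₂ (⊙-Dir u′) t)

    harmonic-net-nonnet : Harmonic σ (fin m) h
    harmonic-net-nonnet = record
      { U = U ; U′ = U′
      ; U≢σ = λ { refl → m₂≢0 (-x≡0⇒x≡0 netσ) }
      ; partner = λ a da → let (x , a≡) = generate a da
                               (t , x≡) = ⊗-combination-surjective m₂≢0 (inj₂ 2≢0) x
                               a≡net = trans a≡ (cong (_⊙ (u₀ , u₁)) x≡) in
          nonnet t , nonnet-Dir t , subst (λ a → Dir U (nonnet t -ᵥ a)) (sym a≡net) (Dir-U t) ,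
          subst (λ a → Dir U′ (nonnet t -ᵥ h ·ᵥ a)) (sym a≡net) (Dir-U′ t) }

    -- The same quadruple read from the other side: net - 2 nonnet = - 2 (nonnet - h net), so the
    -- factor is inverted.
    harmonic-nonnet-net : Harmonic (fin m) σ (1# + 1#)
    harmonic-nonnet-net = record
      { U = U ; U′ = U′
      ; U≢σ = λ e → *-≢0 2≢0 m₂≢0 (modulo (cong proj₂ (fin-injective e)) (- 1#)
          (solve 1 (λ m → (:1 :+ :1) :* m := :0 :+ :- :1 :* (:- m :- m)) refl (proj₂ m)))
      ; partner = λ a da → let (t , x≡) = ⊗-combination-surjective m₂≢0 nonzero (proj₁ a)
                               a≡nonnet = cong₂ _,_ x≡ (trans da (trans (cong (_⊗ m) x≡) (sym (nonnet-Dir t)))) in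
          net t , Dir-σ _ , subst (λ a → Dir U (net t -ᵥ a)) (sym a≡nonnet) (Dir-flip U {nonnet t} {net t} (Dir-U t)) ,
          subst (λ a → Dir U′ (net t -ᵥ (1# + 1#) ·ᵥ a)) (sym a≡nonnet)
            (subst (Dir U′) (coordinatewise₂ (λ n z → modulo 2h≡1 z (solve 3 (λ h n z →
              :- (:1 :+ :1) :* (n :- h :* z) := z :- (:1 :+ :1) :* n :+ z :* ((:1 :+ :1) :* h :- :1)) refl h n z)) (nonnet t) (net t))
              (Dir-· U′ (- (1# + 1#)) (Dir-U′ t))) }
      where
      nonzero : (u₁ - u₀ * r) ≢ 0# ⊎ u₀ ≢ 0#
      nonzero with u₀ ≟ 0#
      ... | no u₀≢0 = inj₂ u₀≢0
      ... | yes refl = inj₁ λ e → u≢0 (cong (0# ,_) (modulo e 1#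
        (solve 2 (λ r v → v := :0 :+ :1 :* (v :- :0 :* r :- :0)) refl r u₁)))

  module _ (2≢0 : 1# + 1# ≢ 0#) where
    open OddCharacteristic 2≢0

    odd-Harmonic : ∀ {σ τ} → σ ≢ τ → ∃[ γ ] (γ ≢ 0# × γ ≢ 1# × Harmonic σ τ γ)
    odd-Harmonic {σ} {τ} σ≢τ with Net? σ | Net? τ
    ... | yes nσ | yes nτ = - 1# , (λ e → 1≢0 (-x≡0⇒x≡0 e)) , -1≢1 , net-net σ≢τ nσ nτ (- 1#)
    odd-Harmonic {σ} {∞} σ≢τ | no _ | no n = contradiction tt n
    odd-Harmonic {∞} {τ} σ≢τ | no n | no _ = contradiction tt n
    odd-Harmonic {fin m} {fin n} σ≢τ | no m₂≢0 | no n₂≢0 = - 1# , (λ e → 1≢0 (-x≡0⇒x≡0 e)) , -1≢1 ,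
      Transverse⇒Harmonic σ≢τ m₂≢0 n₂≢0 (nonnet-nonnet m₂≢0 n₂≢0)
    odd-Harmonic {σ} {∞} σ≢τ | yes _ | no n = contradiction tt n
    odd-Harmonic {σ} {fin m} σ≢τ | yes nσ | no m₂≢0 =
      let (u , u≢0 , generate , Dir-σ) = Net-generator σ nσ in
      h , ⁻¹-≢0 2≢0 , (λ e → 1≢0 (modulo 2h≡1 1# (modulo e (- (1# + 1#))
        (solve 1 (λ h → :1 := :0 :+ :1 :* ((:1 :+ :1) :* h :- :1) :+ :- (:1 :+ :1) :* (h :- :1)) refl h)))) ,
      harmonic-net-nonnet u≢0 m₂≢0 generate Dir-σ nσ 2≢0
    odd-Harmonic {∞} {τ} σ≢τ | no n | yes _ = contradiction tt n
    odd-Harmonic {fin m} {τ} σ≢τ | no m₂≢0 | yes nτ =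
      let (u , u≢0 , generate , Dir-τ) = Net-generator τ nτ in
      1# + 1# , 2≢0 , (λ e → 1≢0 (modulo e 1# (solve 0 (:1 := :0 :+ :1 :* (:1 :+ :1 :- :1)) refl))) ,
      harmonic-nonnet-net u≢0 m₂≢0 generate Dir-τ nτ 2≢0

  -- A net and a non-net slope through commuting shifts of one operator.

  ⊗-⊝ : ∀ m x y → (x ⊝ y) ⊗ m ≡ (x ⊗ m) ⊝ (y ⊗ m)
  ⊗-⊝ m x y = trans (cong (_⊗ m) (combine x y)) (trans (⊗-linear m 1# x (- 1#) y) (sym (combine (x ⊗ m) (y ⊗ m))))
    where
    combine : ∀ x y → x ⊝ y ≡ (1# · x) ⊕ ((- 1#) · y)
    combine = pointwise₂ (λ x y → solve 2 (λ x y → x :- y := :1 :* x :+ :- :1 :* y) refl x y)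

  x⊝y≡0⇒x≡y : ∀ {x y} → x ⊝ y ≡ 0H → x ≡ y
  x⊝y≡0⇒x≡y e = cong₂ _,_ (x-y≡0⇒x≡y (cong proj₁ e)) (x-y≡0⇒x≡y (cong proj₂ e))

  ⊙-injective : ∀ {u} → u ≢ 0H → ∀ {x y} → x ⊙ u ≡ y ⊙ u → x ≡ y
  ⊙-injective u≢0 e with ≢0H u≢0
  ... | inj₁ u₀≢0 = cong₂ _,_ (*-cancelˡ u₀≢0 (cong (proj₁ ∘ proj₁) e)) (*-cancelˡ u₀≢0 (cong (proj₂ ∘ proj₁) e))
  ... | inj₂ u₁≢0 = cong₂ _,_ (*-cancelˡ u₁≢0 (cong (proj₁ ∘ proj₂) e)) (*-cancelˡ u₁≢0 (cong (proj₂ ∘ proj₂) e))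

  module Shifts {m : H} (m₂≢0 : proj₂ m ≢ 0#) (α : Carrier) {β : Carrier} (β≢0 : β ≢ 0#) where
    S : Carrier → H → H
    S ρ x = ((α + ρ) · x) ⊕ (β · (x ⊗ m))

    -- Abstract here and below, since with-abstraction over these witnesses would normalise their proofs.
    abstract
      S-surjective : ∀ ρ x → ∃[ t ] x ≡ S ρ t
      S-surjective ρ = ⊗-combination-surjective m₂≢0 (inj₂ β≢0)

    -- A nonzero kernel vector would be an eigenvector of m, with eigenvalue - (α + ρ) / β.
    S-kernel : ∀ ρ {x} → S ρ x ≡ 0H → x ≡ 0H
    S-kernel ρ {x} e = ⊗-no-eigenvector m₂≢0 {c = - (b * (α + ρ))}
      (cong₂ _,_ (part (cong proj₁ e)) (part (cong proj₂ e)))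
      where
      b = β ⁻¹
      part : ∀ {x p} → (α + ρ) * x + β * p ≡ 0# → p ≡ - (b * (α + ρ)) * x
      part {x} {p} e = modulo e b (modulo (⁻¹-inverse β β≢0) (- p) (solve 6 (λ α ρ β b x p →
        p := :- (b :* (α :+ ρ)) :* x :+ b :* ((α :+ ρ) :* x :+ β :* p :- :0) :+ :- p :* (β :* b :- :1)) refl α ρ β b x p))

    S-injective : ∀ ρ {x y} → S ρ x ≡ S ρ y → x ≡ y
    S-injective ρ {x} {y} e = x⊝y≡0⇒x≡y (S-kernel ρ (trans
      (cong (λ p → ((α + ρ) · (x ⊝ y)) ⊕ (β · p)) (⊗-⊝ m x y))
      (trans (cong₂ _,_ (part _ _ _ _) (part _ _ _ _))
        (trans (cong (_⊝ S ρ y) e) (pointwise₁ -‿inverseʳ (S ρ y))))))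
      where
      part : ∀ x y p q → (α + ρ) * (x - y) + β * (p - q) ≡ (α + ρ) * x + β * p - ((α + ρ) * y + β * q)
      part = solve 7 (λ α ρ β x y p q →
        (α :+ ρ) :* (x :- y) :+ β :* (p :- q) := (α :+ ρ) :* x :+ β :* p :- ((α :+ ρ) :* y :+ β :* q)) refl α ρ β

    S-comm : ∀ μ ν x → S μ (S ν x) ≡ S ν (S μ x)
    S-comm μ ν x = trans (expand μ ν) (trans (pointwise₂ (λ x p → solve 8 (λ α β μ ν r s x p →
        (α :+ μ) :* ((α :+ ν) :* x :+ β :* p) :+ β :* ((α :+ ν) :* p :+ β :* (r :* p :+ s :* x))
        := (α :+ ν) :* ((α :+ μ) :* x :+ β :* p) :+ β :* ((α :+ μ) :* p :+ β :* (r :* p :+ s :* x)))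
        refl α β μ ν r s x p) x (x ⊗ m)) (sym (expand ν μ)))
      where
      expand : ∀ μ ν → S μ (S ν x) ≡
        ((α + μ) · S ν x) ⊕ (β · (((α + ν) · (x ⊗ m)) ⊕ (β · ((r · (x ⊗ m)) ⊕ (s · x)))))
      expand μ ν = cong (λ p → ((α + μ) · S ν x) ⊕ (β · p))
        (trans (⊗-linear m (α + ν) x β (x ⊗ m)) (cong (λ p → ((α + ν) · (x ⊗ m)) ⊕ (β · p)) (⊗-square m₂≢0 x)))

    S-cancel : ∀ {x} → x ≢ 0H → ∀ {μ ν} → S μ x ≡ S ν x → μ ≡ ν
    S-cancel {x} x≢0 {μ} {ν} e with (μ - ν) ≟ 0#
    ... | yes d≡0 = x-y≡0⇒x≡y d≡0
    ... | no d≢0 = contradiction (·-≡0 d≢0 (trans (pointwise₂ (λ x p → solve 6 (λ α β μ ν x p →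
        (μ :- ν) :* x := (α :+ μ) :* x :+ β :* p :- ((α :+ ν) :* x :+ β :* p)) refl α β μ ν x p) x (x ⊗ m))
        (trans (cong (_⊝ S ν x) e) (pointwise₁ -‿inverseʳ (S ν x))))) x≢0

    -- Put L = S 0, so that S ρ = L + ρ. With L (a − b) = κ a + μ b, the vector t = (a − b) / (μ + κ) satisfies
    -- (L + μ) t = a and (L − κ) t = b.
    module _ {a b} (D≢0 : det a b ≢ 0#) {κ μ} (e : S 0# (a ⊝ b) ≡ (κ · a) ⊕ (μ · b)) where
      μ+κ≢0 : μ + κ ≢ 0#
      -- If κ = - μ, then (L + μ)(a - b) = 0, which forces a = b.
      μ+κ≢0 k≡0 = D≢0 (trans (cong (det a) (sym (x⊝y≡0⇒x≡y (S-kernel μ (cong₂ _,_ (part (cong proj₁ e)) (part (cong proj₂ e)))))))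
        (solve 2 (λ x y → x :* y :- y :* x := :0) refl (proj₁ a) (proj₂ a)))
        where
        part : ∀ {a b p} → (α + 0#) * (a - b) + β * p ≡ κ * a + μ * b → (α + μ) * (a - b) + β * p ≡ 0#
        part {a} {b} {p} e = modulo e 1# (modulo k≡0 a (solve 7 (λ α β κ μ a b p →
          (α :+ μ) :* (a :- b) :+ β :* p := :0 :+ :1 :* ((α :+ :0) :* (a :- b) :+ β :* p :- (κ :* a :+ μ :* b))
            :+ a :* (μ :+ κ :- :0)) refl α β κ μ a b p))

      private
        d : Carrier
        d = (μ + κ) ⁻¹

      common-solution : H
      common-solution = d · (a ⊝ b)

      common-solution₁ : a ≡ S μ common-solution
      common-solution₁ = sym (trans (cong (λ p → ((α + μ) · common-solution) ⊕ (β · p)) (⊗-· m d (a ⊝ b)))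
        (cong₂ _,_ (part (cong proj₁ e)) (part (cong proj₂ e))))
        where
        part : ∀ {a b p} → (α + 0#) * (a - b) + β * p ≡ κ * a + μ * b → (α + μ) * (d * (a - b)) + β * (d * p) ≡ a
        part {a} {b} {p} e = modulo e d (modulo (⁻¹-inverse (μ + κ) μ+κ≢0) a (solve 8 (λ α β κ μ d a b p →
          (α :+ μ) :* (d :* (a :- b)) :+ β :* (d :* p)
          := a :+ d :* ((α :+ :0) :* (a :- b) :+ β :* p :- (κ :* a :+ μ :* b)) :+ a :* ((μ :+ κ) :* d :- :1)) refl α β κ μ d a b p))

      common-solution₂ : b ≡ S (- κ) common-solution
      common-solution₂ = sym (trans (cong (λ p → ((α - κ) · common-solution) ⊕ (β · p)) (⊗-· m d (a ⊝ b)))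
        (cong₂ _,_ (part (cong proj₁ e)) (part (cong proj₂ e))))
        where
        part : ∀ {a b p} → (α + 0#) * (a - b) + β * p ≡ κ * a + μ * b → (α - κ) * (d * (a - b)) + β * (d * p) ≡ b
        part {a} {b} {p} e = modulo e d (modulo (⁻¹-inverse (μ + κ) μ+κ≢0) b (solve 8 (λ α β κ μ d a b p →
          (α :- κ) :* (d :* (a :- b)) :+ β :* (d :* p)
          := b :+ d :* ((α :+ :0) :* (a :- b) :+ β :* p :- (κ :* a :+ μ :* b)) :+ b :* ((μ :+ κ) :* d :- :1)) refl α β κ μ d a b p))

    abstract
      -- The shifts are read off from the coordinates of L (a - b) in the basis a, b. Any
      -- independent pair is thereby brought into the form that `pencil` requires.
      S-common : ∀ {a b} → det a b ≢ 0# → ∃[ μ ] ∃[ ν ] ∃[ t ] (μ ≢ ν × a ≡ S μ t × b ≡ S ν t)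
      S-common {a} {b} D≢0 =
        let (κ , μ , e) = det≢0⇒basis D≢0 (S 0# (a ⊝ b)) in
        μ , - κ , common-solution D≢0 e ,
        (λ μ≡-κ → μ+κ≢0 D≢0 e (trans (cong (_+ κ) μ≡-κ) (solve 1 (λ κ → :- κ :+ κ := :0) refl κ))) ,
        common-solution₁ D≢0 e , common-solution₂ D≢0 e

  -- Coordinates on a net line and a non-net line in which every net slope is seen as a translate of one linear map.
  record Chart (σ τ : Slope) : Set where
    field
      m        : H
      m₂≢0     : proj₂ m ≢ 0#
      α        : Carrier
      β        : Carrier
      β≢0      : β ≢ 0#
    open Shifts {m} m₂≢0 α {β} β≢0 public
    field
      u        : H
      u≢0      : u ≢ 0H
      on-σ     : ∀ x → Dir σ (x ⊙ u)
      param-σ  : ∀ v → Dir σ v → ∃[ x ] v ≡ x ⊙ u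
      h        : H → Point
      h-inj    : ∀ {x y} → h x ≡ h y → x ≡ y
      h-·      : ∀ c x → h (c · x) ≡ c ·ᵥ h x
      on-τ     : ∀ x → Dir τ (h x)
      param-τ  : ∀ v → Dir τ v → ∃[ x ] v ≡ h x
      incident : ∀ ρ → ∃[ U ] (∀ z → Dir U (h z -ᵥ (S ρ z ⊙ u)))

  module _ {σ τ} (chart : Chart σ τ) where
    open Chart chart

    ⊙≡0 : ∀ {x} → x ⊙ u ≡ 0ᵥ → x ≡ 0H
    ⊙≡0 e = ⊙-injective u≢0 (trans e (sym (cong₂ _,_ (pointwise₁ (λ _ → zeroʳ _) 0H) (pointwise₁ (λ _ → zeroʳ _) 0H))))

    h≡0 : ∀ {x} → h x ≡ 0ᵥ → x ≡ 0H
    h≡0 {x} e = h-inj (trans e (trans (sym (0·ᵥ (h 0H))) (trans (sym (h-· 0# 0H)) (cong h (pointwise₁ zeroˡ 0H)))))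

    -- The points z of τ and x of σ are joined in the net direction belonging to ρ when x = S ρ z.
    -- One line carries the products of two of the three shifts applied to y, the other the single
    -- shifts. As shifts commute, the opposite joins for AB, AC and BC have the directions of ρ, μ
    -- and ν respectively.
    pencil : ∀ {y} → y ≢ 0H → ∀ {μ ν ρ} → μ ≢ ν → ρ ≢ μ → ρ ≢ ν →
      Affine σ τ (S ρ (S μ y) ⊙ u) (S ρ (S ν y) ⊙ u) (S μ (S ν y) ⊙ u) (h (S ν y)) (h (S μ y)) (h (S ρ y))
    pencil {y} y≢0 {μ} {ν} {ρ} μ≢ν ρ≢μ ρ≢ν = record
      { on = on-σ _ , on-σ _ , on-σ _
      ; on′ = on-τ _ , on-τ _ , on-τ _
      ; nonzero = SS≢0 ρ μ ∘ ⊙≡0 , SS≢0 ρ ν ∘ ⊙≡0 , SS≢0 μ ν ∘ ⊙≡0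
      ; nonzero′ = S≢0 ν ∘ h≡0 , S≢0 μ ∘ h≡0 , S≢0 ρ ∘ h≡0
      ; distinct = (λ e → μ≢ν (S-cancel y≢0 (S-injective ρ (⊙-injective u≢0 e))))
          , (λ e → ρ≢ν (S-cancel y≢0 (S-injective μ (trans (S-comm μ ρ y) (⊙-injective u≢0 e)))))
          , (λ e → ρ≢μ (S-cancel (S≢0 ν) (⊙-injective u≢0 e)))
      ; distinct′ = (λ e → μ≢ν (sym (S-cancel y≢0 (h-inj e)))) , (λ e → ρ≢ν (sym (S-cancel y≢0 (h-inj e))))
          , (λ e → ρ≢μ (sym (S-cancel y≢0 (h-inj e))))
      ; ab = along ρ refl refl
      ; ac = along μ (S-comm ρ μ y) refl
      ; bc = along ν (S-comm ρ ν y) (S-comm μ ν y) }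
      where
      S≢0 : ∀ ρ → S ρ y ≢ 0H
      S≢0 ρ = y≢0 ∘ S-kernel ρ
      SS≢0 : ∀ ρ μ → S ρ (S μ y) ≢ 0H
      SS≢0 ρ μ = S≢0 μ ∘ S-kernel ρ
      along : ∀ ρ {x x′ z z′} → x ≡ S ρ z → x′ ≡ S ρ z′ → Par (h z -ᵥ (x ⊙ u)) (h z′ -ᵥ (x′ ⊙ u))
      along ρ {z = z} {z′} refl refl = let (U , d) = incident ρ in U , d z , d z′

    module _ (squares : ∀ {c} → c ≢ 1# → c * c ≢ 1#) {γ} (γ≢0 : γ ≢ 0#) (γ≢1 : γ ≢ 1#) where

      abstract
        third : ∀ {μ ν : Carrier} → μ ≢ ν → ∃[ ρ ] (ρ ≢ μ × ρ ≢ ν)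
        third {μ} {ν} μ≢ν with 0# ≟ μ | 0# ≟ ν | 1# ≟ μ | 1# ≟ ν
        ... | no 0≢μ   | no 0≢ν   | _        | _        = 0# , 0≢μ , 0≢ν
        ... | yes refl | _        | _        | no 1≢ν   = 1# , 1≢0 , 1≢ν
        ... | yes refl | _        | _        | yes refl = γ , γ≢0 , γ≢1
        ... | no _     | yes refl | no 1≢μ   | _        = 1# , 1≢μ , 1≢0
        ... | no _     | yes refl | yes refl | _        = γ , γ≢1 , γ≢0

      proportional : ∀ {σ τ a b} c → b ≡ c ·ᵥ a → Dir σ a → a ≢ 0ᵥ → b ≢ 0ᵥ → a ≢ b → Completable σ τ a b
      proportional {a = a} c refl da a≢0 b≢0 a≢b = proportional-case c (λ { refl → b≢0 (0·ᵥ a) }) c≢1 (squares c≢1) da a≢0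
        where
        c≢1 : c ≢ 1#
        c≢1 refl = a≢b (sym (1·ᵥ a))

      chart-net : ∀ {a b} → Dir σ a → Dir σ b → a ≢ 0ᵥ → b ≢ 0ᵥ → a ≢ b → Completable σ τ a b
      chart-net {a} {b} da db a≢0 b≢0 a≢b with param-σ a da | param-σ b db
      ... | x , refl | y , refl with det x y ≟ 0#
      ... | yes D≡0 = let (c , e) = det≡0⇒proportional x≢0 D≡0 in
        proportional c (trans (cong (_⊙ u) e) (cong₂ _,_ (swap-scalars _ c x) (swap-scalars _ c x))) da a≢0 b≢0 a≢b
        where
        x≢0 : x ≢ 0H
        x≢0 refl = a≢0 (cong₂ _,_ (pointwise₁ (λ _ → zeroʳ _) 0H) (pointwise₁ (λ _ → zeroʳ _) 0H))
        swap-scalars : ∀ c d x → c · (d · x) ≡ d · (c · x)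
        swap-scalars c d = pointwise₁ (λ x → solve 3 (λ c d x → c :* (d :* x) := d :* (c :* x)) refl c d x)
      ... | no D≢0 with S-common D≢0
      ... | μ , ν , t , μ≢ν , refl , refl with third μ≢ν
      ... | ρ , ρ≢μ , ρ≢ν with S-surjective ρ t
      -- On the net line the pencil's points carry two shifts each, so t is divided by `S ρ` first.
      ... | w , refl = subst₂ (λ a b → Completable σ τ (a ⊙ u) (b ⊙ u)) (S-comm ρ μ w) (S-comm ρ ν w)
        (_ , _ , _ , _ , pencil {w} (λ { refl → D≢0 degenerate }) μ≢ν ρ≢μ ρ≢ν)
        where
        degenerate : det (S μ (S ρ 0H)) (S ν (S ρ 0H)) ≡ 0#
        degenerate = trans (cong (λ z → det (S μ z) (S ν z)) (S0 ρ)) (trans (cong₂ det (S0 μ) (S0 ν))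
          (solve 0 (:0 :* :0 :- :0 :* :0 := :0) refl))
          where
          S0 : ∀ ρ → S ρ 0H ≡ 0H
          S0 ρ = trans (cong (λ p → ((α + ρ) · 0H) ⊕ (β · p)) (0⊗ m))
            (pointwise₁ (λ _ → solve 3 (λ α ρ β → (α :+ ρ) :* :0 :+ β :* :0 := :0) refl α ρ β) 0H)

      chart-nonnet : ∀ {a b} → Dir τ a → Dir τ b → a ≢ 0ᵥ → b ≢ 0ᵥ → a ≢ b → Completable τ σ a b
      chart-nonnet {a} {b} da db a≢0 b≢0 a≢b with param-τ a da | param-τ b db
      ... | x , refl | y , refl with det x y ≟ 0#
      ... | yes D≡0 = let (c , e) = det≡0⇒proportional x≢0 D≡0 in
        proportional c (trans (cong h e) (h-· c x)) da a≢0 b≢0 a≢b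
        where
        x≢0 : x ≢ 0H
        x≢0 refl = a≢0 (trans (cong h (sym (pointwise₁ zeroˡ 0H))) (trans (h-· 0# 0H) (0·ᵥ (h 0H))))
      ... | no D≢0 with S-common D≢0
      ... | μ , ν , t , μ≢ν , refl , refl with third μ≢ν
      -- On the non-net line the points carry one shift each, so t itself generates the pencil;
      -- exchanging μ and ν puts the given points in order.
      ... | ρ , ρ≢μ , ρ≢ν = _ , _ , _ , _ , Affine-dual (pencil {t} t≢0 (μ≢ν ∘ sym) ρ≢ν ρ≢μ)
        where
        t≢0 : t ≢ 0H
        t≢0 refl = a≢0 (trans (cong h (trans (cong (λ p → ((α + μ) · 0H) ⊕ (β · p)) (0⊗ m))
            (pointwise₁ (λ _ → solve 3 (λ α ρ β → (α :+ ρ) :* :0 :+ β :* :0 := :0 :* :0) refl α μ β) 0H)))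
          (trans (h-· 0# 0H) (0·ᵥ (h 0H))))

  -- For σ = ∞ the operator L is m itself; for σ = c it is (c - m)⁻¹. In both cases h z - S ρ z ⊙ u
  -- is z times a fixed element of F² that depends only on ρ, hence of net slope.
  net-chart : ∀ σ {m} → Net σ → proj₂ m ≢ 0# → Chart σ (fin m)
  net-chart ∞ {m} _ m₂≢0 = let (u , u≢0 , param , on) = Net-generator ∞ tt in record
    { m = m ; m₂≢0 = m₂≢0 ; α = 0# ; β = 1# ; β≢0 = 1≢0 ; u = u ; u≢0 = u≢0 ; on-σ = on ; param-σ = param
    ; h = λ z → z , z ⊗ m
    ; h-inj = cong proj₁
    ; h-· = λ c x → cong (c · x ,_) (⊗-· m c x)
    ; on-τ = λ _ → refl
    ; param-τ = λ { (x , _) refl → x , refl }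
    ; incident = λ ρ → let (U , d) = ⊙-Dir (1# , - ρ) in U , λ z → subst (Dir U) (cong₂ _,_
        (pointwise₂ (λ z p → solve 3 (λ ρ z p → :1 :* z := z :- :0 :* ((:0 :+ ρ) :* z :+ :1 :* p)) refl ρ z p) z (z ⊗ m))
        (pointwise₂ (λ z p → solve 3 (λ ρ z p → :- ρ :* z := p :- :1 :* ((:0 :+ ρ) :* z :+ :1 :* p)) refl ρ z p) z (z ⊗ m)))
        (d z) }
  net-chart (fin (c , _)) {m} refl m₂≢0 = let (u , u≢0 , param , on) = Net-generator (fin (c , 0#)) refl in record
    { m = m ; m₂≢0 = m₂≢0 ; α = i * (c - r) ; β = i ; β≢0 = i≢0 ; u = u ; u≢0 = u≢0 ; on-σ = on ; param-σ = param
    ; h = h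
    ; h-inj = λ {x} {y} e → trans (sym (recover x)) (trans (cong (λ v → (c · proj₁ v) ⊝ proj₂ v) e) (recover y))
    ; h-· = λ d x → cong₂ _,_ (K-· d x) (trans (cong (λ k → (c · k) ⊝ (d · x)) (K-· d x)) (pointwise₂ (λ x k →
        solve 4 (λ c d x k → c :* (d :* k) :- d :* x := d :* (c :* k :- x)) refl c d x k) x (K x)))
    ; on-τ = h-Dir
    ; param-τ = λ { (x , _) refl → let (z , e) = ⊗-combination-surjective m₂≢0 (inj₂ i≢0) x in z ,
        cong₂ _,_ e (trans (cong (_⊗ m) e) (sym (h-Dir z))) }
    ; incident = λ ρ → let (U , d) = ⊙-Dir (- ρ , - 1# - c * ρ) in U , λ z → subst (Dir U) (cong₂ _,_
        (pointwise₂ (λ z p → solve 5 (λ a i ρ z p →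
          :- ρ :* z := a :* z :+ i :* p :- :1 :* ((a :+ ρ) :* z :+ i :* p)) refl (i * (c - r)) i ρ z p) z (z ⊗ m))
        (pointwise₂ (λ z p → solve 6 (λ c a i ρ z p →
          (:- :1 :- c :* ρ) :* z := c :* (a :* z :+ i :* p) :- z :- c :* ((a :+ ρ) :* z :+ i :* p)) refl c (i * (c - r)) i ρ z p) z (z ⊗ m)))
        (d z) }
    where
    i = f c ⁻¹
    i≢0 = ⁻¹-≢0 (f≢0 c)
    -- K is (c - m)⁻¹: since (c - m)(c - r + m) = f(c), it equals (c - r + m) / f(c). Therefore c K
    -- z - z = (K z) ⊗ m, which puts `h z` on slope m.
    K : H → H
    K z = ((i * (c - r)) · z) ⊕ (i · (z ⊗ m))
    h : H → Point
    h z = K z , (c · K z) ⊝ z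
    recover : ∀ x → (c · K x) ⊝ ((c · K x) ⊝ x) ≡ x
    recover x = pointwise₂ (λ k x → solve 2 (λ k x → k :- (k :- x) := x) refl k x) (c · K x) x
    K-· : ∀ d x → K (d · x) ≡ d · K x
    K-· d x = trans (cong (λ p → ((i * (c - r)) · d · x) ⊕ (i · p)) (⊗-· m d x)) (pointwise₂ (λ x p →
      solve 5 (λ a i d x p → a :* (d :* x) :+ i :* (d :* p) := d :* (a :* x :+ i :* p)) refl (i * (c - r)) i d x p) x (x ⊗ m))
    h-Dir : ∀ z → Dir (fin m) (h z)
    h-Dir z = sym (trans (⊗-linear m (i * (c - r)) z i (z ⊗ m))
      (trans (cong (λ q → ((i * (c - r)) · (z ⊗ m)) ⊕ (i · q)) (⊗-square m₂≢0 z))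
        (pointwise₂ (λ z p → modulo (⁻¹-inverse (f c) (f≢0 c)) (- z) (solve 6 (λ r s c i z p →
          i :* (c :- r) :* p :+ i :* (r :* p :+ s :* z)
          := c :* (i :* (c :- r) :* z :+ i :* p) :- z :+ :- z :* (:f r s c :* i :- :1)) refl r s c i z p)) z (z ⊗ m))))

  -- Characteristic 2, including the plane of order 4.

  module EvenCharacteristic (2≡0 : 1# + 1# ≡ 0#) where

    -- In characteristic 2, c² - 1 = (c - 1)².
    square≢1 : ∀ {c} → c ≢ 1# → c * c ≢ 1#
    square≢1 {c} c≢1 e = *-≢0 d≢0 d≢0 (modulo e 1# (modulo 2≡0 (1# - c) (solve 1 (λ c →
      (c :- :1) :* (c :- :1) := :0 :+ :1 :* (c :* c :- :1) :+ (:1 :- c) :* (:1 :+ :1 :- :0)) refl c)))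
      where
      d≢0 : c - 1# ≢ 0#
      d≢0 k = c≢1 (x-y≡0⇒x≡y k)

    even-case : ∀ {γ} → γ ≢ 0# → γ ≢ 1# → ∀ {σ τ} → σ ≢ τ →
      ∀ {a b} → Dir σ a → Dir σ b → a ≢ 0ᵥ → b ≢ 0ᵥ → a ≢ b → Completable σ τ a b
    even-case {γ} γ≢0 γ≢1 {σ} {τ} σ≢τ with Net? σ | Net? τ
    ... | yes nσ | yes nτ = harmonic-case γ≢0 γ≢1 (net-net σ≢τ nσ nτ γ)
    even-case γ≢0 γ≢1 {σ} {∞} σ≢τ | no _ | no n = contradiction tt n
    even-case γ≢0 γ≢1 {∞} {τ} σ≢τ | no n | no _ = contradiction tt n
    even-case γ≢0 γ≢1 {fin m} {fin n} σ≢τ | no m₂≢0 | no n₂≢0 = harmonic-case γ≢0 γ≢1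
      (Transverse⇒Harmonic σ≢τ m₂≢0 n₂≢0
        (nonnet-nonnet-generic m₂≢0 n₂≢0 γ≢0 (square≢1 γ≢1) (square≢1 (square≢1 γ≢1))))
    even-case γ≢0 γ≢1 {σ} {∞} σ≢τ | yes _ | no n = contradiction tt n
    even-case γ≢0 γ≢1 {σ} {fin m} σ≢τ | yes nσ | no m₂≢0 = chart-net (net-chart σ nσ m₂≢0) square≢1 γ≢0 γ≢1
    even-case γ≢0 γ≢1 {∞} {τ} σ≢τ | no n | yes _ = contradiction tt n
    even-case γ≢0 γ≢1 {fin m} {τ} σ≢τ | no m₂≢0 | yes nτ = chart-nonnet (net-chart τ nτ m₂≢0) square≢1 γ≢0 γ≢1

    -- Over F₂ the plane is the affine plane over F₄, and E is multiplication by a primitive element of F₄.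
    module Order4 (two : ∀ x → x ≡ 0# ⊎ x ≡ 1#) where

      -1≡1 : - 1# ≡ 1#
      -1≡1 = modulo 2≡0 (- 1#) (solve 0 (:- :1 := :1 :+ :- :1 :* (:1 :+ :1 :- :0)) refl)

      s≡1 : s ≡ 1#
      s≡1 with two s
      ... | inj₁ s≡0 = contradiction s≡0 s≢0
      ... | inj₂ s≡1 = s≡1

      r≡1 : r ≡ 1#
      r≡1 with two r
      ... | inj₂ r≡1 = r≡1
      ... | inj₁ r≡0 = contradiction (1# , 1# , trans 2≡0 (sym r≡0) , trans (*-identityˡ 1#) (trans (sym -1≡1) (cong -_ (sym s≡1)))) irreducible

      ω : H
      ω = (0# , 1#)

      ⊗-ω² : ∀ x → (x ⊗ ω) ⊗ ω ≡ (x ⊗ ω) ⊕ x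
      ⊗-ω² x = trans (⊗-square 1≢0 x) (trans (cong₂ (λ r s → (r · (x ⊗ ω)) ⊕ (s · x)) r≡1 s≡1)
        (cong₂ _⊕_ (pointwise₁ *-identityˡ (x ⊗ ω)) (pointwise₁ *-identityˡ x)))

      -- Over F₂ the only non-scalar elements are ω and its conjugate, whose right multiplication is
      -- r minus that of ω.
      ⊗-ω-comm : ∀ m x → (x ⊗ m) ⊗ ω ≡ (x ⊗ ω) ⊗ m
      ⊗-ω-comm (m₁ , m₂) x with two m₂ | two m₁
      ... | inj₁ refl | _ = trans (cong (_⊗ ω) (⊗-scalar refl x)) (trans (⊗-· ω m₁ x) (sym (⊗-scalar refl (x ⊗ ω))))
      ... | inj₂ refl | inj₁ refl = refl
      ... | inj₂ refl | inj₂ refl = trans (cong (_⊗ ω) (conj x)) (trans (⊗-⊝ ω (r · x) (x ⊗ ω))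
          (trans (cong (_⊝ ((x ⊗ ω) ⊗ ω)) (⊗-· ω r x)) (sym (conj (x ⊗ ω)))))
        where
        conj : ∀ x → x ⊗ (1# , 1#) ≡ (r · x) ⊝ (x ⊗ ω)
        conj x = trans (cong (x ⊗_) (cong₂ _,_ (trans (sym r≡1) (solve 1 (λ r → r := r :- :0) refl r)) (sym -1≡1))) (⊗-conjugate 1≢0 x)

      E : Point → Point
      E (x , y) = (x ⊗ ω , y ⊗ ω)

      E-Dir : ∀ σ {v} → Dir σ v → Dir σ (E v)
      E-Dir ∞       refl = 0⊗ ω
      E-Dir (fin m) {x , _} refl = ⊗-ω-comm m x

      E² : ∀ v → E (E v) ≡ E v +ᵥ v
      E² (x , y) = cong₂ _,_ (⊗-ω² x) (⊗-ω² y)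

      E-- : ∀ v w → E (v -ᵥ w) ≡ E v -ᵥ E w
      E-- (x , y) (x′ , y′) = cong₂ _,_ (⊗-⊝ ω x x′) (⊗-⊝ ω y y′)

      E-no-eigenvector : ∀ {v} → v ≢ 0ᵥ → ∀ c → E v ≢ c ·ᵥ v
      E-no-eigenvector v≢0 c e = v≢0 (cong₂ _,_ (⊗-no-eigenvector 1≢0 (cong proj₁ e)) (⊗-no-eigenvector 1≢0 (cong proj₂ e)))

      E-span : ∀ σ {a} → Dir σ a → a ≢ 0ᵥ → ∀ b → Dir σ b → ∃[ α ] ∃[ β ] b ≡ α ·ᵥ a +ᵥ β ·ᵥ E a
      E-span ∞ {_ , y} refl a≢0 (_ , y′) refl =
        let (α , β , e) = det≢0⇒basis (det-⊗≢0 {ω} {y} 1≢0 (λ { refl → a≢0 refl })) y′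
        in α , β , cong₂ _,_ (sym (Dir-combination ∞ {0H , y} {E (0H , y)} α β refl (0⊗ ω))) e
      E-span (fin m) {a@(x , _)} refl a≢0 (x′ , _) refl =
        let (α , β , e) = det≢0⇒basis (det-⊗≢0 {ω} {x} 1≢0 (λ { refl → a≢0 (cong (0H ,_) (0⊗ m)) })) x′
        in α , β , cong₂ _,_ e (trans (cong (_⊗ m) e) (sym (Dir-combination (fin m) {a} {E a} α β refl (⊗-ω-comm m x))))

      -- The geometric progressions of `proportional-case` over F₄ with ratio ω: as ω² = 1 + ω and
      -- ω³ = 1, they read a, ω a, ω² a and z, ω² z, ω z.
      E-Affine : ∀ {σ τ a z} → Dir σ a → a ≢ 0ᵥ → Dir τ z → z ≢ 0ᵥ →
        Affine σ τ a (E a) (a +ᵥ E a) z (z +ᵥ E z) (E z)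
      E-Affine {σ} {τ} {a} {z} da a≢0 dz z≢0 = record
        { on = da , E-Dir σ da , Dir-+ σ da (E-Dir σ da)
        ; on′ = dz , Dir-+ τ dz (E-Dir τ dz) , E-Dir τ dz
        ; nonzero = a≢0 , E≢0 a≢0 , a+Ea≢0 a≢0
        ; nonzero′ = z≢0 , a+Ea≢0 z≢0 , E≢0 z≢0
        ; distinct = a≢Ea a≢0 , a≢a+Ea a≢0 , Ea≢a+Ea a≢0
        ; distinct′ = a≢a+Ea z≢0 , a≢Ea z≢0 , Ea≢a+Ea z≢0 ∘ sym
        ; ab = subst (λ v → Par v (z -ᵥ E a)) (sym (trans
              (coordinatewise₄ (λ z p a q → modulo 2≡0 q (solve 4 (λ z p a q →
                z :+ p :- a := z :- q :+ (p :- (q :+ a)) :+ q :* (:1 :+ :1 :- :0)) refl z p a q)) z (E z) a (E a))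
              (cong ((z -ᵥ E a) +ᵥ_) (sym (trans (E-- z (E a)) (cong (E z -ᵥ_) (E² a)))))))
            (orbit₂ (z -ᵥ E a))
        ; ac = subst₂ Par
            (trans (trans (E-- (z -ᵥ a) (E a)) (cong₂ _-ᵥ_ (E-- z a) (E² a)))
              (coordinatewise₃ (λ p a q → modulo 2≡0 (- q) (solve 3 (λ p a q →
                p :- q :- (q :+ a) := p :- a :+ :- q :* (:1 :+ :1 :- :0)) refl p a q)) (E z) a (E a)))
            (coordinatewise₃ (λ z a q → solve 3 (λ z a q → z :- a :- q := z :- (a :+ q)) refl z a q) z a (E a))
            (orbit₁ (z -ᵥ a -ᵥ E a))
        ; bc = subst₂ Par (E-- z a)
            (trans (cong ((z -ᵥ a) +ᵥ_) (E-- z a))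
              (coordinatewise₄ (λ z p a q → solve 4 (λ z p a q → z :- a :+ (p :- q) := z :+ p :- (a :+ q)) refl z p a q) z (E z) a (E a)))
            (let (σ , d) = Dir-exists (z -ᵥ a) in σ , E-Dir σ d , Dir-+ σ d (E-Dir σ d)) }
        where
        orbit₁ : ∀ v → Par (E v) v
        orbit₁ v = let (σ , d) = Dir-exists v in σ , E-Dir σ d , d
        orbit₂ : ∀ v → Par (v +ᵥ E v) v
        orbit₂ v = let (σ , d) = Dir-exists v in σ , Dir-+ σ d (E-Dir σ d) , d
        E≢0 : ∀ {a} → a ≢ 0ᵥ → E a ≢ 0ᵥ
        E≢0 {a} a≢0 e = E-no-eigenvector a≢0 0# (trans e (sym (0·ᵥ a)))
        a≢Ea : ∀ {a} → a ≢ 0ᵥ → a ≢ E a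
        a≢Ea {a} a≢0 e = E-no-eigenvector a≢0 1# (trans (sym e) (sym (1·ᵥ a)))
        a+Ea≢0 : ∀ {a} → a ≢ 0ᵥ → a +ᵥ E a ≢ 0ᵥ
        a+Ea≢0 {a} a≢0 e = E-no-eigenvector a≢0 (- 1#) (trans
          (coordinatewise₂ (λ a q → solve 2 (λ a q → q := a :+ q :+ :- :1 :* a) refl a q) a (E a))
          (trans (cong (_+ᵥ (- 1#) ·ᵥ a) e) (coordinatewise₁ +-identityˡ ((- 1#) ·ᵥ a))))
        a≢a+Ea : ∀ {a} → a ≢ 0ᵥ → a ≢ a +ᵥ E a
        a≢a+Ea {a} a≢0 e = E≢0 a≢0 (+ᵥ-cancelˡ a (trans (sym e) (sym (coordinatewise₁ +-identityʳ a))))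
        Ea≢a+Ea : ∀ {a} → a ≢ 0ᵥ → E a ≢ a +ᵥ E a
        Ea≢a+Ea {a} a≢0 e = a≢0 (trans ([a+b]-b≡a a (E a)) (trans (cong (_-ᵥ E a) (sym e)) (v-v≡0 (E a))))
          where [a+b]-b≡a = coordinatewise₂ (λ a b → solve 2 (λ a b → a := a :+ b :- b) refl a b)

      -- A slope plane consists of 0, a, E a and a + E a, so b is the second or the third point of
      -- `E-Affine`.
      order4-case : ∀ {σ τ a b} → Dir σ a → Dir σ b → a ≢ 0ᵥ → b ≢ 0ᵥ → a ≢ b → Completable σ τ a b
      order4-case {σ} {τ} {a} {b} da db a≢0 b≢0 a≢b with nonzero-in τ | E-span σ da a≢0 b db
      ... | z , dz , z≢0 | α , β , b≡ = cases (two α) (two β)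
        where
        simplify : ∀ {k l} → α ≡ k → β ≡ l → b ≡ k ·ᵥ a +ᵥ l ·ᵥ E a
        simplify refl refl = b≡
        A = E-Affine {σ} {τ} da a≢0 dz z≢0
        cases : α ≡ 0# ⊎ α ≡ 1# → β ≡ 0# ⊎ β ≡ 1# → Completable σ τ a b
        cases (inj₁ α≡0) (inj₁ β≡0) = contradiction (trans (simplify α≡0 β≡0)
          (coordinatewise₂ (λ x y → solve 2 (λ x y → :0 :* x :+ :0 :* y := :0) refl x y) a (E a))) b≢0
        cases (inj₂ α≡1) (inj₁ β≡0) = contradiction (sym (trans (simplify α≡1 β≡0)
          (coordinatewise₂ (λ x y → solve 2 (λ x y → :1 :* x :+ :0 :* y := x) refl x y) a (E a)))) a≢b
        cases (inj₁ α≡0) (inj₂ β≡1) = subst (Completable σ τ a)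
          (sym (trans (simplify α≡0 β≡1) (coordinatewise₂ (λ x y → solve 2 (λ x y → :0 :* x :+ :1 :* y := y) refl x y) a (E a))))
          (_ , _ , _ , _ , A)
        cases (inj₂ α≡1) (inj₂ β≡1) = subst (Completable σ τ a)
          (sym (trans (simplify α≡1 β≡1) (coordinatewise₂ (λ x y → solve 2 (λ x y → :1 :* x :+ :1 :* y := x :+ y) refl x y) a (E a))))
          (_ , _ , _ , _ , Affine-swap A)

  -- Assembly of the cases.

  third-scalar? : Dec (∃[ γ ] (γ ≢ 0# × γ ≢ 1#))
  third-scalar? with any? (λ i → ¬? (Inverse.from card i ≟ 0#) ×-dec ¬? (Inverse.from card i ≟ 1#))
  ... | yes (i , γ) = yes (Inverse.from card i , γ)
  ... | no none = no λ { (γ , γ≢0 , γ≢1) → none (Inverse.to card γ ,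
          subst (λ γ → γ ≢ 0# × γ ≢ 1#) (sym (Inverse.strictlyInverseʳ card γ)) (γ≢0 , γ≢1)) }

  completable : ∀ {σ τ} → σ ≢ τ → ∀ {a b} → Dir σ a → Dir σ b → a ≢ 0ᵥ → b ≢ 0ᵥ → a ≢ b → Completable σ τ a b
  completable σ≢τ with (1# + 1#) ≟ 0# | third-scalar?
  ... | no 2≢0 | _ = let (γ , γ≢0 , γ≢1 , G) = odd-Harmonic 2≢0 σ≢τ in harmonic-case γ≢0 γ≢1 G
  ... | yes 2≡0 | yes (γ , γ≢0 , γ≢1) = EvenCharacteristic.even-case 2≡0 γ≢0 γ≢1 σ≢τ
  ... | yes 2≡0 | no none = EvenCharacteristic.Order4.order4-case 2≡0 two
    where
    two : ∀ x → x ≡ 0# ⊎ x ≡ 1#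
    two x with x ≟ 0# | x ≟ 1#
    ... | yes x≡0 | _       = inj₁ x≡0
    ... | no _    | yes x≡1 = inj₂ x≡1
    ... | no x≢0  | no x≢1  = contradiction (x , x≢0 , x≢1) none

  pappus : ∀ ℓ₁ ℓ₂ → ¬ SameLine ℓ₁ ℓ₂ → ∀ A₁ B₁ → A₁ ≢ B₁ → A₁ ∈L ℓ₁ → B₁ ∈L ℓ₁ → ¬ A₁ ∈L ℓ₂ → ¬ B₁ ∈L ℓ₂ →
    ∃[ C₁ ] ∃[ A₂ ] ∃[ B₂ ] ∃[ C₂ ] PappusConfiguration ℓ₁ ℓ₂ A₁ B₁ C₁ A₂ B₂ C₂
  pappus ℓ₁ ℓ₂ ℓ₁≢ℓ₂ A B A≢B A∈ℓ₁ B∈ℓ₁ A∉ℓ₂ B∉ℓ₂ with slope ℓ₁ ≟ₛ slope ℓ₂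
  ... | yes σ≡τ = parallel-case ℓ₁≢ℓ₂ σ≡τ A≢B A∈ℓ₁ B∈ℓ₁
  ... | no σ≢τ with slope≢⇒meet ℓ₁ ℓ₂ σ≢τ
  ... | O , O∈ℓ₁ , O∈ℓ₂ with completable σ≢τ (difference-Dir ℓ₁ O∈ℓ₁ A∈ℓ₁) (difference-Dir ℓ₁ O∈ℓ₁ B∈ℓ₁)
      (λ e → A∉ℓ₂ (subst (_∈L ℓ₂) (sym (v-w≡0⇒v≡w e)) O∈ℓ₂)) (λ e → B∉ℓ₂ (subst (_∈L ℓ₂) (sym (v-w≡0⇒v≡w e)) O∈ℓ₂))
      (λ e → A≢B (trans (sym (P+[Q-P]≡Q O A)) (trans (cong (O +ᵥ_) e) (P+[Q-P]≡Q O B))))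
  ... | c , a′ , b′ , c′ , conf = O +ᵥ c , O +ᵥ a′ , O +ᵥ b′ , O +ᵥ c′ ,
    subst₂ (λ A B → PappusConfiguration ℓ₁ ℓ₂ A B (O +ᵥ c) (O +ᵥ a′) (O +ᵥ b′) (O +ᵥ c′))
      (P+[Q-P]≡Q O A) (P+[Q-P]≡Q O B) (Affine⇒Pappus {ℓ₁} {ℓ₂} ℓ₁≢ℓ₂ σ≢τ O∈ℓ₁ O∈ℓ₂ conf)

theorem3p3 : (q : ℕ) → IsPrimePower q → (F : FiniteField q) → (r s : FiniteField.Carrier F) →
    Hall.Irreducible F r s →
    (ℓ₁ ℓ₂ : Hall.Line F r s) → ¬ Hall.SameLine F r s ℓ₁ ℓ₂ →
    (A₁ B₁ : Hall.Point F r s) → A₁ ≢ B₁ →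
    Hall._∈L_ F r s A₁ ℓ₁ → Hall._∈L_ F r s B₁ ℓ₁ →
    ¬ Hall._∈L_ F r s A₁ ℓ₂ → ¬ Hall._∈L_ F r s B₁ ℓ₂ →
    ∃[ C₁ ] ∃[ A₂ ] ∃[ B₂ ] ∃[ C₂ ] Hall.PappusConfiguration F r s ℓ₁ ℓ₂ A₁ B₁ C₁ A₂ B₂ C₂
theorem3p3 q _ F r s irreducible = HallPlane.pappus F r s irreducible
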